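{- Let $G$ be a cyclic group of prime-power order. Then \[\Delta^{\ast}(G)\cap\mathbb N_{\ge(2|G|^2)^{1/3}}=\bigcup_{m\mid |G|} I(m)\cap\mathbb N_{\ge(2|G|^2)^{1/3}}.\]
   Context: $\mathbb N_{\ge a}=\{k\in\mathbb N:k\ge a\}$. For $G_0\subseteq G$: $\mathcal B(G_0)$ is the monoid of zero-sum sequences over $G_0$, whose atoms are the minimal zero-sum sequences; $\mathsf L(B)$ is the set of lengths of factorizations of $B$ into minimal zero-sum sequences; for $L=\{\ell_1<\dots<\ell_k\}$, $\Delta(L)=\{\ell_{i+1}-\ell_i\}$; $\Delta(G_0)=\bigcup_B\Delta(\mathsf L(B))$; $\min\Delta(G_0)$ is its minimum. $\Delta^{\ast}(G)=\{\min\Delta(G_0):G_0\subseteq G,\ \Delta(G_0)\ne\emptyset\}$. For a positive integer $n$: $M(n)$ is the set of triples $(c_1,c_2,d)$ of positive integers with $c_1,c_2\in[1,n]$, $d\mid n$, such that $\frac{n-c_1-c_2}{c_1c_2}$ and $\frac{(n-c_1-c_2)d}{c_2n}$ are positive integers; $I(n)$ is the set of all integers $\gcd\left\{\frac{n-c_1-c_2}{c_1c_2},\frac{(n-c_1-c_2)d}{c_2n}\right\}$ with $(c_1,c_2,d)\in M(n)$. -}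

module Defs where

open import Data.Nat using (ℕ; zero; suc; _+_; _*_; _∸_; _^_; _≤_; _<_)
open import Data.Nat.Divisibility using (_∣_)
open import Data.Nat.GCD using (gcd)
open import Data.Fin using (Fin; toℕ)
open import Data.Fin.Subset using (Subset; _∈_)
open import Data.List using (List; []; _∷_; length; map; allFin)
open import Data.Nat.ListAction using (sum)
open import Data.List.Relation.Unary.All using (All)
open import Data.Product using (Σ; ∃; _×_; _,_)
open import Data.Empty using (⊥)
open import Relation.Binary.PropositionalEquality using (_≡_)

-- The cyclic group of order n is modelled as ℤ/nℤ with carrier Fin n
-- (element g ↔ residue toℕ g).  A sequence over G (an element of the free
-- abelian monoid over G) is given by its multiplicity function.
Seq : ℕ → Set
Seq n = Fin n → ℕ

_≤ₛ_ : {n : ℕ} → Seq n → Seq n → Set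
w ≤ₛ v = ∀ g → w g ≤ v g

len : {n : ℕ} → Seq n → ℕ
len {n} v = sum (map v (allFin n))

-- σ(S) as a natural number representative (to be read mod n)
σ : {n : ℕ} → Seq n → ℕ
σ {n} v = sum (map (λ g → v g * toℕ g) (allFin n))

ZeroSum : {n : ℕ} → Seq n → Set
ZeroSum {n} v = n ∣ σ v

Over : {n : ℕ} → Subset n → Seq n → Set
Over G0 v = ∀ g → 0 < v g → g ∈ G0

MinZeroSum : {n : ℕ} → Seq n → Set
MinZeroSum {n} v =
  ZeroSum v × 0 < len v ×
  (∀ (w : Seq n) → w ≤ₛ v → ZeroSum w → 0 < len w → ∀ g → w g ≡ v g)

prodList : {n : ℕ} → List (Seq n) → Seq n
prodList [] g = 0
prodList (v ∷ vs) g = v g + prodList vs g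

InL : {n : ℕ} → Seq n → ℕ → Set
InL {n} B ℓ =
  Σ (List (Seq n)) λ fs → length fs ≡ ℓ × All MinZeroSum fs × (∀ g → prodList fs g ≡ B g)

InΔ : (ℕ → Set) → ℕ → Set
InΔ L d = 0 < d × ∃ λ ℓ → L ℓ × L (ℓ + d) × (∀ ℓ' → L ℓ' → ℓ < ℓ' → ℓ' < ℓ + d → ⊥)

InΔG0 : {n : ℕ} → Subset n → ℕ → Set
InΔG0 {n} G0 d = Σ (Seq n) λ B → ZeroSum B × Over G0 B × InΔ (InL B) d

-- d = min Δ(G0)  (which in particular forces Δ(G0) ≠ ∅)
IsMinΔ : {n : ℕ} → Subset n → ℕ → Set
IsMinΔ G0 d = InΔG0 G0 d × (∀ d' → InΔG0 G0 d' → d ≤ d')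

InΔstar : ℕ → ℕ → Set
InΔstar n d = Σ (Subset n) λ G0 → IsMinΔ G0 d

InI : ℕ → ℕ → Set
InI m x =
  Σ ℕ λ c₁ → Σ ℕ λ c₂ → Σ ℕ λ d →
    1 ≤ c₁ × c₁ ≤ m × 1 ≤ c₂ × c₂ ≤ m × d ∣ m ×
    c₁ + c₂ < m ×
    Σ ℕ λ a → Σ ℕ λ b →
      1 ≤ a × a * (c₁ * c₂) ≡ m ∸ c₁ ∸ c₂ ×
      1 ≤ b × b * (c₂ * m) ≡ (m ∸ c₁ ∸ c₂) * d ×
      x ≡ gcd a b

{-# OPTIONS --safe #-}
-- The subgroup generated by a subset G₀ of a cyclic p-group is generated by some e ∈ G₀, say of order m.
-- Writing g = ι(g) e with 1 ≤ ι(g) ≤ m, a zero-sum sequence U over G₀ has a norm N(U) = Σ ι(g) / m, and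
-- min Δ(G₀) is the gcd of all N(U) - 1, U an atom.  Suppose x = min Δ(G₀) is large.
-- If h = ι(g) does not divide m, write m = c h + s with 0 < s < h and t = gcd(h, m); the vertices of the
-- cone of zero-sum sequences over {e, g} then give h = A s + t with x ∣ A.  For two such g, an atom mixing
-- both shows that s is the same, whence all such h are multiples j h of the smallest one.
-- A value d = ι(g) dividing m either divides s or satisfies h / t = 1 + b m / d with x ∣ b.
-- For a configuration of this shape all norms are 1 modulo gcd(A, b), with b coming from the smallest d of
-- the second kind, and this gcd is the element of I(m / t) attached to (s / t, c, d / t).  Conversely that
-- element is the minimal distance of {e, h e, d e}.
module Submission where

open import Defs
open import Data.Nat
open import Data.Nat.Properties
open import Data.Nat.Divisibility
open import Data.Nat.DivMod using (_/_; _%_; m≡m%n+[m/n]*n; m%n<n; m<n⇒m%n≡m; [m+kn]%n≡m%n; m*n/n≡m; m*[n/m]≡n; m≥n⇒m/n>0)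
open import Data.Nat.GCD using (gcd; gcd[m,n]∣m; gcd[m,n]∣n; gcd-greatest; gcd[m,n]≡0⇒m≡0; gcd[m,n]≡0⇒n≡0; c*gcd[m,n]≡gcd[cm,cn]; gcd-GCD; module Bézout)
import Data.Nat.Coprimality as Coprimality
open Coprimality using (Coprime; gcd≡1⇒coprime; coprime-Bézout; coprime-divisor)
open import Data.Nat.ListAction using (sum)
open import Data.Nat.Primality using (Prime; prime⇒nonZero; prime⇒irreducible)
open import Data.Nat.Tactic.RingSolver using (solve-∀)
open import Data.Fin using (Fin; toℕ; fromℕ<) renaming (zero to fzero; suc to fsuc)
open import Data.Fin.Properties using (any?; toℕ-fromℕ<)
open import Data.Fin.Subset using (Subset; _∈_; ⁅_⁆; _∪_)
open import Data.Fin.Subset.Properties using (_∈?_; x∈⁅x⁆; x∈⁅y⁆⇒x≡y; x∈p∪q⁻; x∈p∪q⁺)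
open import Data.List using (List; []; _∷_; map; allFin; length; _++_)
open import Data.List.Properties using (map-tabulate; length-++)
open import Data.List.Relation.Unary.All using (All; []; _∷_)
open import Data.List.Relation.Unary.All.Properties using (++⁺)
open import Data.Product using (Σ; ∃; ∃₂; _×_; _,_; proj₁; proj₂)
open import Data.Sum using (_⊎_; inj₁; inj₂; [_,_]′)
open import Data.Empty using (⊥; ⊥-elim)
open import Function using (_∘_; id)
open import Function.Bundles using (_⇔_; mk⇔)
open import Relation.Nullary using (¬_; Dec; yes; no; contradiction)
open import Relation.Nullary.Decidable using (decidable-stable; _×-dec_; ¬?)
open import Relation.Binary.PropositionalEquality hiding (J)

-- Weighted sums of sequences

-- Prime powers enter through `DivisorChain`: the divisors of the group order are totally ordered by
-- divisibility. This puts a generator inside G₀, and it makes weights dividing m behave like nested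
-- coins from which exact amounts can be paid (`fill`); such payments cut norm-one divisors out of
-- would-be atoms. The size of x enters through congruences. From 2m² ≤ x³ follows 2m ≤ x², so any a
-- with a x ≤ m satisfies 2a ≤ x. Norms are 1 modulo x, and the numbers compared are of this size,
-- so congruent ones are equal. The cubic inequality itself is needed where two weights not dividing
-- m meet: the estimate there contains the product of two quotients, each bounded by m / x, and 2m ≤
-- x² alone does not keep that product below x.

private variable
  n : ℕ

module _ {A : Set} where
  Σ-cong : (xs : List A) {f g : A → ℕ} → (∀ x → f x ≡ g x) → sum (map f xs) ≡ sum (map g xs)
  Σ-cong [] e = refl
  Σ-cong (x ∷ xs) e = cong₂ _+_ (e x) (Σ-cong xs e)

  Σ-mono : (xs : List A) {f g : A → ℕ} → (∀ x → f x ≤ g x) → sum (map f xs) ≤ sum (map g xs)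
  Σ-mono [] e = z≤n
  Σ-mono (x ∷ xs) e = +-mono-≤ (e x) (Σ-mono xs e)

  Σ-+ : (xs : List A) (f g : A → ℕ) →
        sum (map (λ x → f x + g x) xs) ≡ sum (map f xs) + sum (map g xs)
  Σ-+ [] f g = refl
  Σ-+ (x ∷ xs) f g rewrite Σ-+ xs f g = interchange (f x) (g x) _ _
    where interchange : ∀ a b c d → a + b + (c + d) ≡ a + c + (b + d)
          interchange = solve-∀

  Σ-*ˡ : (xs : List A) (k : ℕ) (f : A → ℕ) → sum (map (λ x → k * f x) xs) ≡ k * sum (map f xs)
  Σ-*ˡ [] k f = sym (*-zeroʳ k)
  Σ-*ˡ (x ∷ xs) k f rewrite Σ-*ˡ xs k f = sym (*-distribˡ-+ k (f x) _)

Σ-suc : (F : Fin (suc n) → ℕ) → sum (map F (allFin (suc n))) ≡ F fzero + sum (map (F ∘ fsuc) (allFin n))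
Σ-suc F = cong (λ xs → F fzero + sum xs) (trans (map-tabulate fsuc F) (sym (map-tabulate id (F ∘ fsuc))))

Σ-term : (F : Fin n → ℕ) (i : Fin n) → F i ≤ sum (map F (allFin n))
Σ-term F fzero = m≤m+n _ _
Σ-term {suc n} F (fsuc i) rewrite Σ-suc F = ≤-trans (Σ-term (F ∘ fsuc) i) (m≤n+m _ (F fzero))

infix 4 _≐_
infixl 21 _⊕_ _⊖_
infixl 22 _⊙_

_≐_ : Seq n → Seq n → Set
v ≐ w = ∀ g → v g ≡ w g

_⊕_ _⊖_ : Seq n → Seq n → Seq n
(v ⊕ w) g = v g + w g
(v ⊖ w) g = v g ∸ w g

_⊙_ : ℕ → Seq n → Seq n
(k ⊙ v) g = k * v g

δ : Fin n → Seq n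
δ fzero fzero = 1
δ fzero (fsuc _) = 0
δ (fsuc _) fzero = 0
δ (fsuc i) (fsuc j) = δ i j

δ-self : (i : Fin n) → δ i i ≡ 1
δ-self fzero = refl
δ-self (fsuc i) = δ-self i

δ-supp : (i j : Fin n) → 0 < δ i j → i ≡ j
δ-supp fzero fzero _ = refl
δ-supp (fsuc i) (fsuc j) p = cong fsuc (δ-supp i j p)

⟨_,_⟩ : Seq n → (Fin n → ℕ) → ℕ
⟨_,_⟩ {n} v f = sum (map (λ g → v g * f g) (allFin n))

module _ {n : ℕ} where
  ⟨⟩-congˡ : {v w : Seq n} (f : Fin n → ℕ) → v ≐ w → ⟨ v , f ⟩ ≡ ⟨ w , f ⟩
  ⟨⟩-congˡ f e = Σ-cong (allFin n) λ g → cong (_* f g) (e g)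

  ⟨⟩-congʳ : (v : Seq n) {f h : Fin n → ℕ} → (∀ g → 0 < v g → f g ≡ h g) → ⟨ v , f ⟩ ≡ ⟨ v , h ⟩
  ⟨⟩-congʳ v {f} {h} e = Σ-cong (allFin n) λ g → at g (v g) refl
    where at : ∀ g k → v g ≡ k → v g * f g ≡ v g * h g
          at g zero q rewrite q = refl
          at g (suc k) q = cong (v g *_) (e g (subst (0 <_) (sym q) z<s))

  ⟨⟩-monoˡ : {v w : Seq n} (f : Fin n → ℕ) → v ≤ₛ w → ⟨ v , f ⟩ ≤ ⟨ w , f ⟩
  ⟨⟩-monoˡ f le = Σ-mono (allFin n) λ g → *-monoˡ-≤ (f g) (le g)

  ⟨⟩-⊕ : (v w : Seq n) (f : Fin n → ℕ) → ⟨ v ⊕ w , f ⟩ ≡ ⟨ v , f ⟩ + ⟨ w , f ⟩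
  ⟨⟩-⊕ v w f = trans (Σ-cong (allFin n) λ g → *-distribʳ-+ (f g) (v g) (w g)) (Σ-+ (allFin n) _ _)

  ⟨⟩-⊙ : (k : ℕ) (v : Seq n) (f : Fin n → ℕ) → ⟨ k ⊙ v , f ⟩ ≡ k * ⟨ v , f ⟩
  ⟨⟩-⊙ k v f = trans (Σ-cong (allFin n) λ g → *-assoc k (v g) (f g)) (Σ-*ˡ (allFin n) k _)

  ⟨⟩-+ʳ : (v : Seq n) (f h : Fin n → ℕ) → ⟨ v , (λ g → f g + h g) ⟩ ≡ ⟨ v , f ⟩ + ⟨ v , h ⟩
  ⟨⟩-+ʳ v f h = trans (Σ-cong (allFin n) λ g → *-distribˡ-+ (v g) (f g) (h g)) (Σ-+ (allFin n) _ _)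

  ⟨⟩-*ʳ : (v : Seq n) (k : ℕ) (f : Fin n → ℕ) → ⟨ v , (λ g → k * f g) ⟩ ≡ k * ⟨ v , f ⟩
  ⟨⟩-*ʳ v k f = trans (Σ-cong (allFin n) λ g → comm (v g) k (f g)) (Σ-*ˡ (allFin n) k _)
    where comm : ∀ a b c → a * (b * c) ≡ b * (a * c)
          comm = solve-∀

  len-⟨⟩ : (v : Seq n) → len v ≡ ⟨ v , (λ _ → 1) ⟩
  len-⟨⟩ v = Σ-cong (allFin n) λ g → sym (*-identityʳ (v g))

  ⟨⟩-term : (v : Seq n) (f : Fin n → ℕ) (g : Fin n) → v g * f g ≤ ⟨ v , f ⟩
  ⟨⟩-term v f g = Σ-term (λ g → v g * f g) g

  ⟨⟩-∣ : (v : Seq n) (f : Fin n → ℕ) (d : ℕ) → (∀ g → 0 < v g → d ∣ f g) → d ∣ ⟨ v , f ⟩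
  ⟨⟩-∣ v f d e = go (allFin n)
    where
    at : ∀ g k → v g ≡ k → d ∣ v g * f g
    at g zero q rewrite q = d ∣0
    at g (suc k) q = ∣n⇒∣m*n (v g) (e g (subst (0 <_) (sym q) z<s))
    go : ∀ xs → d ∣ sum (map (λ g → v g * f g) xs)
    go [] = d ∣0
    go (x ∷ xs) = ∣m∣n⇒∣m+n (at x (v x) refl) (go xs)

  ⊖-⊕ : {v w : Seq n} → w ≤ₛ v → w ⊕ (v ⊖ w) ≐ v
  ⊖-⊕ le g = m+[n∸m]≡n (le g)

  ⟨⟩-⊖ : {v w : Seq n} (f : Fin n → ℕ) → w ≤ₛ v → ⟨ v , f ⟩ ≡ ⟨ w , f ⟩ + ⟨ v ⊖ w , f ⟩
  ⟨⟩-⊖ {v} {w} f le = trans (⟨⟩-congˡ f (λ g → sym (⊖-⊕ le g))) (⟨⟩-⊕ w (v ⊖ w) f)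

  ⊖-≤ : (v w : Seq n) → (v ⊖ w) ≤ₛ v
  ⊖-≤ v w g = m∸n≤m (v g) (w g)

⟨δ⟩ : (i : Fin n) (f : Fin n → ℕ) → ⟨ δ i , f ⟩ ≡ f i
⟨δ⟩ {suc n} fzero f rewrite Σ-suc (λ g → δ fzero g * f g) = trans (cong₂ _+_ (+-identityʳ (f fzero)) (Σ-*ˡ (allFin n) 0 (λ _ → 0))) (+-identityʳ _)
⟨δ⟩ {suc n} (fsuc i) f rewrite Σ-suc (λ g → δ (fsuc i) g * f g) = ⟨δ⟩ i (f ∘ fsuc)

⟨⊙δ⟩ : (k : ℕ) (i : Fin n) (f : Fin n → ℕ) → ⟨ k ⊙ δ i , f ⟩ ≡ k * f i
⟨⊙δ⟩ k i f = trans (⟨⟩-⊙ k (δ i) f) (cong (k *_) (⟨δ⟩ i f))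

module _ {n : ℕ} where
  δ≤ : (v : Seq n) (i : Fin n) → 0 < v i → δ i ≤ₛ v
  δ≤ v i p g with δ i g in q
  ... | zero = z≤n
  ... | suc k with δ-supp i g (subst (0 <_) (sym q) z<s)
  ...   | refl = subst (_≤ v i) (trans (sym (δ-self i)) q) p

  ≤ₛ-antisym-sum : {v w : Seq n} (f : Fin n → ℕ) → (∀ g → 0 < f g) →
                   w ≤ₛ v → ⟨ w , f ⟩ ≡ ⟨ v , f ⟩ → w ≐ v
  ≤ₛ-antisym-sum {v} {w} f pos le e g = ≤-antisym (le g) (m∸n≡0⇒m≤n (diff≡0 (v g ∸ w g) refl))
    where
    total≡0 : ⟨ v ⊖ w , f ⟩ ≡ 0
    total≡0 = +-cancelˡ-≡ ⟨ w , f ⟩ _ _ (trans (sym (⟨⟩-⊖ f le)) (trans (sym e) (sym (+-identityʳ _))))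
    diff≡0 : ∀ k → v g ∸ w g ≡ k → v g ∸ w g ≡ 0
    diff≡0 zero q = q
    diff≡0 (suc k) q = contradiction
      (≤-trans (*-mono-≤ {1} {v g ∸ w g} {1} {f g} (subst (1 ≤_) (sym q) (s≤s z≤n)) (pos g))
               (≤-trans (⟨⟩-term (v ⊖ w) f g) (≤-reflexive total≡0)))
      λ ()

  split-≤ : {w a b : Seq n} → w ≤ₛ a ⊕ b →
            Σ (Seq n) λ w₁ → Σ (Seq n) λ w₂ → w₁ ≤ₛ a × w₂ ≤ₛ b × w₁ ⊕ w₂ ≐ w
  split-≤ {w} {a} {b} le = (λ g → w g ⊓ a g) , (λ g → w g ∸ a g) ,
    (λ g → m⊓n≤n (w g) (a g)) ,
    (λ g → ≤-trans (∸-monoˡ-≤ (a g) (le g)) (≤-reflexive (m+n∸m≡n (a g) (b g)))) ,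
    (λ g → trans (cong (_+ (w g ∸ a g)) (⊓-comm (w g) (a g))) (m⊓n+n∸m≡n (a g) (w g)))

  ≤⊙δ : {w : Seq n} {k : ℕ} (i : Fin n) → w ≤ₛ k ⊙ δ i → w i ≤ k × (w ≐ w i ⊙ δ i)
  ≤⊙δ {w} {k} i le = subst (w i ≤_) (trans (cong (k *_) (δ-self i)) (*-identityʳ k)) (le i) , eq
    where
    eq : ∀ g → w g ≡ w i * δ i g
    eq g with δ i g in q
    ... | zero = trans (n≤0⇒n≡0 (subst (w g ≤_) (trans (cong (k *_) q) (*-zeroʳ k)) (le g))) (sym (*-zeroʳ (w i)))
    ... | suc m with δ-supp i g (subst (0 <_) (sym q) z<s)
    ...   | refl = sym (trans (cong (w i *_) (trans (sym q) (δ-self i))) (*-identityʳ (w i)))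

  ≤⊙δ-sum : {w : Seq n} {k : ℕ} (i : Fin n) → w ≤ₛ k ⊙ δ i →
            ∃ λ a → a ≤ k × (∀ f → ⟨ w , f ⟩ ≡ a * f i)
  ≤⊙δ-sum {w} {k} i le = w i , proj₁ (≤⊙δ {k = k} i le) ,
    λ f → trans (⟨⟩-congˡ f (proj₂ (≤⊙δ {k = k} i le))) (⟨⊙δ⟩ (w i) i f)

  pair : ℕ → Fin n → ℕ → Fin n → Seq n
  pair a i b j = a ⊙ δ i ⊕ b ⊙ δ j

  ⟨pair⟩ : ∀ a i b j f → ⟨ pair a i b j , f ⟩ ≡ a * f i + b * f j
  ⟨pair⟩ a i b j f = trans (⟨⟩-⊕ (a ⊙ δ i) (b ⊙ δ j) f) (cong₂ _+_ (⟨⊙δ⟩ a i f) (⟨⊙δ⟩ b j f))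

  ≤pair : {w : Seq n} {a b : ℕ} {i j : Fin n} → w ≤ₛ pair a i b j →
          ∃₂ λ a′ b′ → a′ ≤ a × b′ ≤ b × (∀ f → ⟨ w , f ⟩ ≡ a′ * f i + b′ * f j)
  ≤pair {w} {i = i} {j} le with split-≤ le
  ... | w₁ , w₂ , le₁ , le₂ , e with ≤⊙δ-sum i le₁ | ≤⊙δ-sum j le₂
  ... | a′ , a′≤ , s₁ | b′ , b′≤ , s₂ = a′ , b′ , a′≤ , b′≤ ,
    λ f → trans (⟨⟩-congˡ f (λ g → sym (e g))) (trans (⟨⟩-⊕ w₁ w₂ f) (cong₂ _+_ (s₁ f) (s₂ f)))

  nonempty : (v : Seq n) → (∃ λ g → 0 < v g) ⊎ (∀ g → v g ≡ 0)
  nonempty v with any? (λ g → 0 <? v g)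
  ... | yes p = inj₁ p
  ... | no ¬p = inj₂ λ g → n≤0⇒n≡0 (≮⇒≥ λ q → ¬p (g , q))

  ⟨⟩-zero : {v : Seq n} (f : Fin n → ℕ) → (∀ g → v g ≡ 0) → ⟨ v , f ⟩ ≡ 0
  ⟨⟩-zero f e = trans (⟨⟩-congˡ f e) (Σ-*ˡ (allFin n) 0 (λ _ → 0))

  ⟨⟩-pos : {v : Seq n} (f : Fin n → ℕ) → 0 < ⟨ v , f ⟩ → ∃ λ g → 0 < v g
  ⟨⟩-pos {v} f p with nonempty v
  ... | inj₁ q = q
  ... | inj₂ z = contradiction (⟨⟩-zero f z) (>⇒≢ p)

  ⟨⟩-pos′ : {v : Seq n} (f : Fin n → ℕ) → (∀ g → 0 < f g) → ∀ g → 0 < v g → 0 < ⟨ v , f ⟩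
  ⟨⟩-pos′ {v} f pos g p = ≤-trans (*-mono-≤ p (pos g)) (⟨⟩-term v f g)

  Seq-ind : (P : Seq n → Set) → (∀ v → (∀ g → v g ≡ 0) → P v) →
            (∀ v i → 0 < v i → P (v ⊖ δ i) → P v) → ∀ v → P v
  Seq-ind P base step v = go (len v) v ≤-refl
    where
    go : ∀ k v → len v ≤ k → P v
    go k v le with nonempty v
    ... | inj₂ z = base v z
    ... | inj₁ (i , p) = next k le
      where
      eq : len v ≡ suc (len (v ⊖ δ i))
      eq = trans (len-⟨⟩ v) (trans (⟨⟩-⊖ (λ _ → 1) (δ≤ v i p))
             (cong₂ _+_ (⟨δ⟩ i (λ _ → 1)) (sym (len-⟨⟩ (v ⊖ δ i)))))
      next : ∀ k → len v ≤ k → P v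
      next zero le = contradiction (trans (sym eq) (n≤0⇒n≡0 le)) λ ()
      next (suc k) le = step v i p (go k (v ⊖ δ i) (s≤s⁻¹ (subst (_≤ suc k) eq le)))

  argmin : {P : Fin n → Set} → (∀ i → Dec (P i)) → (f : Fin n → ℕ) →
           (∃ λ i → P i × (∀ j → P j → f i ≤ f j)) ⊎ (∀ i → ¬ P i)
  argmin {P} P? f with any? P?
  ... | no ¬p = inj₂ λ i p → ¬p (i , p)
  ... | yes (i , p) = inj₁ (go (f i) i p ≤-refl)
    where
    go : ∀ k i → P i → f i ≤ k → ∃ λ i → P i × (∀ j → P j → f i ≤ f j)
    go k i p le with any? (λ j → P? j ×-dec (f j <? f i))
    ... | no ¬q = i , p , λ j q → ≮⇒≥ λ lt → ¬q (j , q , lt)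
    go zero i p le | yes (j , q , lt) = contradiction (≤-trans lt le) λ ()
    go (suc k) i p le | yes (j , q , lt) = go k j q (s≤s⁻¹ (≤-trans lt le))

  -- Removing a smallest item preserves both hypotheses, since along a divisibility chain
  -- the smallest item divides the total as well as R.
  fill : (f : Fin n → ℕ) (R : ℕ) (v : Seq n) →
         (∀ g → 0 < v g → 0 < f g × f g ∣ R) →
         (∀ g h → 0 < v g → 0 < v h → f g ∣ f h ⊎ f h ∣ f g) →
         R ≤ ⟨ v , f ⟩ → Σ (Seq n) λ w → w ≤ₛ v × ⟨ w , f ⟩ ≡ R
  fill f R v = go ⟨ v , f ⟩ v ≤-refl
    where
    go : ∀ k v → ⟨ v , f ⟩ ≤ k →
         (∀ g → 0 < v g → 0 < f g × f g ∣ R) →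
         (∀ g h → 0 < v g → 0 < v h → f g ∣ f h ⊎ f h ∣ f g) →
         R ≤ ⟨ v , f ⟩ → Σ (Seq n) λ w → w ≤ₛ v × ⟨ w , f ⟩ ≡ R
    go k v le div chain R≤ with m≤n⇒m<n∨m≡n R≤
    ... | inj₂ e = v , (λ _ → ≤-refl) , sym e
    ... | inj₁ R< with argmin (λ g → 0 <? v g) f
    ... | inj₂ none = contradiction (⟨⟩-pos f (≤-trans (s≤s z≤n) R<)) λ (g , p) → none g p
    ... | inj₁ (i , p , least) = next k le
      where
      v′ = v ⊖ δ i
      sum-eq : ⟨ v , f ⟩ ≡ f i + ⟨ v′ , f ⟩
      sum-eq = trans (⟨⟩-⊖ f (δ≤ v i p)) (cong (_+ ⟨ v′ , f ⟩) (⟨δ⟩ i f))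
      supp : ∀ g → 0 < v′ g → 0 < v g
      supp g q = ≤-trans q (⊖-≤ v (δ i) g)
      fi∣ : ∀ g → 0 < v g → f i ∣ f g
      fi∣ g q with chain i g p q
      ... | inj₁ d = d
      ... | inj₂ d = ∣-reflexive (≤-antisym (least g q) (∣⇒≤ {{>-nonZero (proj₁ (div i p))}} d))
      fi∣diff : f i ∣ ⟨ v , f ⟩ ∸ R
      fi∣diff = ∣m+n∣m⇒∣n (subst (f i ∣_) (sym (m+[n∸m]≡n R≤)) (⟨⟩-∣ v f (f i) fi∣)) (proj₂ (div i p))
      fi≤diff : f i ≤ ⟨ v , f ⟩ ∸ R
      fi≤diff = ∣⇒≤ {{>-nonZero (m<n⇒0<n∸m R<)}} fi∣diff
      R≤′ : R ≤ ⟨ v′ , f ⟩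
      R≤′ = +-cancelˡ-≤ (f i) R _ (subst (f i + R ≤_) sum-eq
              (≤-trans (+-monoˡ-≤ R fi≤diff) (≤-reflexive (m∸n+n≡m R≤))))
      next : ∀ k → ⟨ v , f ⟩ ≤ k → Σ (Seq n) λ w → w ≤ₛ v × ⟨ w , f ⟩ ≡ R
      next zero le = contradiction (≤-trans R< le) λ ()
      next (suc k) le with go k v′ (s≤s⁻¹ (≤-trans (≤-trans (+-monoˡ-≤ _ (proj₁ (div i p))) (≤-reflexive (sym sum-eq))) le))
                              (λ g q → div g (supp g q)) (λ g h q r → chain g h (supp g q) (supp h r)) R≤′
      ... | w , w≤ , e = w , (λ g → ≤-trans (w≤ g) (⊖-≤ v (δ i) g)) , e

-- Minimal distances and norms of atoms

-- ι g represents g as a multiple of a generator e of the subgroup generated by G₀, which has order m.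
record Indexed (n : ℕ) (G₀ : Subset n) (m : ℕ) : Set where
  field
    ι   : Fin n → ℕ
    ι>0 : ∀ g → 0 < ι g
    ι≤m : ∀ g → ι g ≤ m
    zs⇒ : ∀ {v} → Over G₀ v → ZeroSum v → m ∣ ⟨ v , ι ⟩
    zs⇐ : ∀ {v} → Over G₀ v → m ∣ ⟨ v , ι ⟩ → ZeroSum v
    e   : Fin n
    e∈  : e ∈ G₀
    ιe  : ι e ≡ 1

module _ {n : ℕ} where
  prodList-++ : (fs gs : List (Seq n)) → prodList (fs ++ gs) ≐ prodList fs ⊕ prodList gs
  prodList-++ [] gs g = refl
  prodList-++ (f ∷ fs) gs g = trans (cong (f g +_) (prodList-++ fs gs g)) (sym (+-assoc (f g) _ _))

  InL-⊕ : {B C : Seq n} {k l : ℕ} → InL B k → InL C l → InL (B ⊕ C) (k + l)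
  InL-⊕ (fs , p , q , r) (gs , p′ , q′ , r′) = fs ++ gs ,
    trans (length-++ fs) (cong₂ _+_ p p′) , ++⁺ q q′ ,
    λ g → trans (prodList-++ fs gs g) (cong₂ _+_ (r g) (r′ g))

  InL-≐ : {B C : Seq n} {k l : ℕ} → B ≐ C → k ≡ l → InL B k → InL C l
  InL-≐ e refl (fs , p , q , r) = fs , p , q , λ g → trans (r g) (e g)

  InL-atom : {v : Seq n} → MinZeroSum v → InL v 1
  InL-atom {v} p = v ∷ [] , refl , p ∷ [] , λ g → +-identityʳ (v g)

  InL-zero : {v : Seq n} → (∀ g → v g ≡ 0) → InL v 0
  InL-zero z = [] , refl , [] , λ g → sym (z g)

  InL-⊙ : {v : Seq n} → MinZeroSum v → ∀ k → InL (k ⊙ v) k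
  InL-⊙ p zero = InL-zero λ _ → refl
  InL-⊙ p (suc k) = InL-⊕ (InL-atom p) (InL-⊙ p k)

  InL⇒ZeroSum : {B : Seq n} {k : ℕ} → InL B k → ZeroSum B
  InL⇒ZeroSum {B} (fs , _ , q , r) = subst (n ∣_) (⟨⟩-congˡ toℕ r) (go fs q)
    where
    go : ∀ fs → All MinZeroSum fs → ZeroSum (prodList fs)
    go [] [] = subst (n ∣_) (sym (⟨⟩-zero {n} {prodList []} toℕ λ _ → refl)) (n ∣0)
    go (f ∷ fs) (p ∷ ps) = subst (n ∣_) (sym (⟨⟩-⊕ f (prodList fs) toℕ)) (∣m∣n⇒∣m+n (proj₁ p) (go fs ps))

  Over-⊕ : {G₀ : Subset n} {v w : Seq n} → Over G₀ v → Over G₀ w → Over G₀ (v ⊕ w)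
  Over-⊕ {v = v} ov ow g p with v g in q
  ... | zero = ow g p
  ... | suc k = ov g (subst (0 <_) (sym q) z<s)

  Over-≤ : {G₀ : Subset n} {v w : Seq n} → w ≤ₛ v → Over G₀ v → Over G₀ w
  Over-≤ le ov g p = ov g (≤-trans p (le g))

  Over-⊙ : {G₀ : Subset n} {v : Seq n} (k : ℕ) → Over G₀ v → Over G₀ (k ⊙ v)
  Over-⊙ {v = v} k ov g p with v g in q
  ... | zero = contradiction p (<-irrefl (sym (*-zeroʳ k)))
  ... | suc j = ov g (subst (0 <_) (sym q) z<s)

  Over-δ : {G₀ : Subset n} {i : Fin n} → i ∈ G₀ → Over G₀ (δ i)
  Over-δ {i = i} p g q with δ-supp i g q
  ... | refl = p

  Over-pair : {G₀ : Subset n} {i j : Fin n} (a b : ℕ) → i ∈ G₀ → j ∈ G₀ → Over G₀ (pair a i b j)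
  Over-pair {G₀} {i} {j} a b p q =
    Over-⊕ {G₀} {a ⊙ δ i} {b ⊙ δ j} (Over-⊙ {G₀} {δ i} a (Over-δ p)) (Over-⊙ {G₀} {δ j} b (Over-δ q))

  Over-prodList : {G₀ : Subset n} (f : Seq n) (fs : List (Seq n)) →
                  Over G₀ (prodList (f ∷ fs)) → Over G₀ f × Over G₀ (prodList fs)
  Over-prodList f fs ov = Over-≤ {w = f} (λ g → m≤m+n _ _) ov ,
                          Over-≤ {w = prodList fs} (λ g → m≤n+m _ (f g)) ov

module Relations {n : ℕ} (G₀ : Subset n) where

  -- Other lengths may lie between the two, in contrast to `InΔG0`. Multiplying the underlying
  -- products adds or subtracts the differences, so these numbers are the nonnegative half of a
  -- subgroup of the integers, which the minimal distance generates.
  Rel : ℕ → Set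
  Rel y = Σ (Seq n) λ B → Over G₀ B × ∃ λ ℓ → InL B ℓ × InL B (ℓ + y)

  Rel-+ : ∀ {a b} → Rel a → Rel b → Rel (a + b)
  Rel-+ {a} {b} (B , o , k , p , q) (C , o′ , l , p′ , q′) =
    B ⊕ C , Over-⊕ {G₀ = G₀} {B} {C} o o′ , k + l , InL-⊕ p p′ , InL-≐ (λ _ → refl) (eq k a l b) (InL-⊕ q q′)
    where eq : ∀ k a l b → k + a + (l + b) ≡ k + l + (a + b)
          eq = solve-∀

  Rel-zero : Rel 0
  Rel-zero = (λ _ → 0) , (λ g ()) , 0 , InL-zero (λ _ → refl) , InL-zero (λ _ → refl)

  Rel-* : ∀ {a} k → Rel a → Rel (k * a)
  Rel-* zero r = Rel-zero
  Rel-* (suc k) r = Rel-+ r (Rel-* k r)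

  Rel-sub : ∀ {a b r} → a ≡ b + r → Rel a → Rel b → Rel r
  Rel-sub {a} {b} {r} refl (B , o , k , p , q) (C , o′ , l , p′ , q′) =
    B ⊕ C , Over-⊕ {G₀ = G₀} {B} {C} o o′ , k + (l + b) , InL-⊕ p q′ , InL-≐ (λ _ → refl) (eq k l b r) (InL-⊕ q p′)
    where eq : ∀ k l b r → k + (b + r) + l ≡ k + (l + b) + r
          eq = solve-∀

  Δ⇒Rel : ∀ {x} → InΔG0 G₀ x → Rel x
  Δ⇒Rel (B , _ , o , _ , ℓ , p , q , _) = B , o , ℓ , p , q

  -- A length strictly between ℓ and ℓ + r would give a smaller relation, so the descent ends with
  -- two adjacent lengths, hence with an element of Δ(G₀) below x.
  small-Rel : ∀ {x} → (∀ d → InΔG0 G₀ d → x ≤ d) → ∀ r → 0 < r → r < x → ¬ Rel r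
  small-Rel {x} min r = go r r ≤-refl
    where
    go : ∀ k r → r ≤ k → 0 < r → r < x → ¬ Rel r
    go zero r le pos = contradiction (≤-trans pos le) λ ()
    go (suc k) r le pos lt (B , o , ℓ , p , q) =
      <⇒≱ lt (min r (B , InL⇒ZeroSum p , o , pos , ℓ , p , q , gap))
      where
      gap : ∀ ℓ′ → InL B ℓ′ → ℓ < ℓ′ → ℓ′ < ℓ + r → ⊥
      gap ℓ′ p′ l₁ l₂ = go k (ℓ′ ∸ ℓ) (s≤s⁻¹ (≤-trans r′<r le)) (m<n⇒0<n∸m l₁) (<-trans r′<r lt)
        (B , o , ℓ , p , InL-≐ (λ _ → refl) (sym (m+[n∸m]≡n (<⇒≤ l₁))) p′)
        where
        r′<r : ℓ′ ∸ ℓ < r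
        r′<r = +-cancelˡ-< ℓ _ _ (subst (_< ℓ + r) (sym (m+[n∸m]≡n (<⇒≤ l₁))) l₂)

  minΔ∣Rel : ∀ {x} → IsMinΔ G₀ x → ∀ y → Rel y → x ∣ y
  minΔ∣Rel {zero} ((_ , _ , _ , () , _) , _)
  minΔ∣Rel {x@(suc _)} (inΔ , min) y r = m%n≡0⇒n∣m y x (at (y % x) refl)
    where
    rest : Rel (y % x)
    rest = Rel-sub (trans (m≡m%n+[m/n]*n y x) (+-comm (y % x) _)) r (Rel-* (y / x) (Δ⇒Rel inΔ))
    at : ∀ k → y % x ≡ k → y % x ≡ 0
    at zero q = q
    at (suc k) q = ⊥-elim (small-Rel min (y % x) (subst (0 <_) (sym q) z<s) (m%n<n y x) rest)

module Norm {n : ℕ} {G₀ : Subset n} {m : ℕ} (I : Indexed n G₀ m) where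
  open Indexed I
  open Relations G₀

  0<m : 0 < m
  0<m = ≤-trans (ι>0 e) (ι≤m e)

  instance
    m≢0 : NonZero m
    m≢0 = >-nonZero 0<m

  -- Minimality is stated through norms: as all weights are positive, a divisor of norm 0 is empty
  -- and one of norm N is all of v. Irreducibility thus becomes a question about numbers.
  record Atom (v : Seq n) (N : ℕ) : Set where
    field
      over : Over G₀ v
      norm : ⟨ v , ι ⟩ ≡ N * m
      pos  : 0 < N
      irr  : ∀ w M → w ≤ₛ v → ⟨ w , ι ⟩ ≡ M * m → M ≡ 0 ⊎ M ≡ N

  Atom⇒MinZeroSum : ∀ {v N} → Atom v N → MinZeroSum v
  Atom⇒MinZeroSum {v} {N} A = zs⇐ over (divides N norm) , len-pos , minimal
    where
    open Atom A
    len-pos : 0 < len v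
    len-pos with ⟨⟩-pos ι (subst (0 <_) (sym norm) (*-mono-< pos 0<m))
    ... | g , p = subst (0 <_) (sym (len-⟨⟩ v)) (⟨⟩-pos′ {v = v} (λ _ → 1) (λ _ → z<s) g p)
    minimal : ∀ w → w ≤ₛ v → ZeroSum w → 0 < len w → w ≐ v
    minimal w le z l with zs⇒ (Over-≤ {w = w} le over) z
    ... | divides M eq with irr w M le eq
    ... | inj₂ refl = ≤ₛ-antisym-sum ι ι>0 le (trans eq (sym norm))
    ... | inj₁ refl with ⟨⟩-pos {v = w} (λ _ → 1) (subst (0 <_) (len-⟨⟩ w) l)
    ...   | g , p = contradiction eq (>⇒≢ (⟨⟩-pos′ {v = w} ι ι>0 g p))

  MinZeroSum⇒Atom : ∀ {v} → Over G₀ v → MinZeroSum v → ∃ λ N → Atom v N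
  MinZeroSum⇒Atom {v} ov (z , l , minimal) with zs⇒ ov z
  ... | divides N eq = N , record { over = ov ; norm = eq ; pos = N-pos N eq ; irr = irr′ }
    where
    sum-pos : 0 < ⟨ v , ι ⟩
    sum-pos with ⟨⟩-pos {v = v} (λ _ → 1) (subst (0 <_) (len-⟨⟩ v) l)
    ... | g , p = ⟨⟩-pos′ {v = v} ι ι>0 g p
    N-pos : ∀ N → ⟨ v , ι ⟩ ≡ N * m → 0 < N
    N-pos zero q = contradiction q (>⇒≢ sum-pos)
    N-pos (suc _) _ = z<s
    irr′ : ∀ w M → w ≤ₛ v → ⟨ w , ι ⟩ ≡ M * m → M ≡ 0 ⊎ M ≡ N
    irr′ w zero le q = inj₁ refl
    irr′ w M@(suc _) le q with ⟨⟩-pos ι (subst (0 <_) (sym q) (*-mono-< {0} {M} z<s 0<m))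
    ... | g , p = inj₂ (*-cancelʳ-≡ M N m (trans (sym q) (trans (⟨⟩-congˡ ι w≐v) eq)))
      where
      w≐v : w ≐ v
      w≐v = minimal w le (zs⇐ (Over-≤ {w = w} le ov) (divides M q))
              (subst (0 <_) (sym (len-⟨⟩ w)) (⟨⟩-pos′ {v = w} (λ _ → 1) (λ _ → z<s) g p))

  norm-one : ∀ {v} → Over G₀ v → ⟨ v , ι ⟩ ≡ m → Atom v 1
  norm-one {v} ov q = record { over = ov ; norm = trans q (sym (*-identityˡ m)) ; pos = z<s ; irr = irr′ }
    where
    irr′ : ∀ w M → w ≤ₛ v → ⟨ w , ι ⟩ ≡ M * m → M ≡ 0 ⊎ M ≡ 1
    irr′ w zero le r = inj₁ refl
    irr′ w (suc zero) le r = inj₂ refl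
    irr′ w (suc (suc M)) le r =
      contradiction (≤-trans (≤-reflexive (sym r)) (≤-trans (⟨⟩-monoˡ ι le) (≤-reflexive q)))
        (<⇒≱ (m<m+n m (≤-trans 0<m (m≤m+n m (M * m)))))

  Atom-sub : ∀ {v N w} M → Atom v N → w ≤ₛ v → 0 < M → ⟨ w , ι ⟩ ≡ M * m → N ≡ M
  Atom-sub {w = w} M A le p q with Atom.irr A w M le q
  ... | inj₁ r = contradiction r (>⇒≢ p)
  ... | inj₂ r = sym r

  -- The case X = 0 is meaningful: all atoms have norm one, so there are no distances.
  ModOne : ℕ → Set
  ModOne X = ∀ v N → Atom v N → ∃ λ k → N ≡ suc (k * X)

  -- Norms add up over a factorization and every factor contributes 1 modulo X, so B determines its
  -- lengths modulo X.
  ModOne-lengths : ∀ {X} → ModOne X → ∀ {B ℓ} → Over G₀ B → InL B ℓ → ∃ λ K → ⟨ B , ι ⟩ ≡ (ℓ + K * X) * m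
  ModOne-lengths {X} mod {B} ov (fs , refl , q , r) with
    go fs q (λ g p → ov g (subst (0 <_) (r g) p))
    where
    go : ∀ fs → All MinZeroSum fs → Over G₀ (prodList fs) →
         ∃ λ K → ⟨ prodList fs , ι ⟩ ≡ (length fs + K * X) * m
    go [] [] o = 0 , ⟨⟩-zero ι λ _ → refl
    go (f ∷ fs) (p ∷ ps) o with Over-prodList f fs o
    ... | o₁ , o₂ with MinZeroSum⇒Atom o₁ p | go fs ps o₂
    ... | N , A | K , eq with mod f N A
    ... | k , refl = k + K , trans (⟨⟩-⊕ f (prodList fs) ι)
                       (trans (cong₂ _+_ (Atom.norm A) eq) (ring k X m (length fs) K))
      where ring : ∀ k X m l K → suc (k * X) * m + (l + K * X) * m ≡ (suc l + (k + K) * X) * m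
            ring = solve-∀
  ... | K , eq = K , trans (sym (⟨⟩-congˡ ι r)) eq

  ModOne⇒∣Δ : ∀ {X x} → ModOne X → InΔG0 G₀ x → X ∣ x
  ModOne⇒∣Δ {X} {x} mod (B , _ , o , _ , ℓ , p , q , _) with ModOne-lengths mod o p | ModOne-lengths mod o q
  ... | K , eq | K′ , eq′ = ∣m+n∣m⇒∣n {m = K′ * X} (divides K (trans (+-comm (K′ * X) x) (sym same))) (n∣m*n K′)
    where
    same : K * X ≡ x + K′ * X
    same = +-cancelˡ-≡ ℓ _ _ (trans (*-cancelʳ-≡ _ _ m (trans (sym eq) eq′)) (+-assoc ℓ x _))

  -- U · (eᵐ)^|U| is the product of N copies of eᵐ and of the norm-one atoms g · e^(m - ι g), g ∈ U.
  Atom⇒Rel : ∀ {v y} → Atom v (suc y) → Rel y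
  Atom⇒Rel {v} {y} A = v ⊕ K ⊙ em , Over-⊕ {G₀ = G₀} {v} {K ⊙ em} over (Over-⊙ {v = em} K em-over) , 1 + K ,
    InL-⊕ (InL-atom (Atom⇒MinZeroSum A)) (InL-⊙ em-min K) ,
    InL-≐ same-product same-length (InL-⊕ (complete v over) (InL-⊙ em-min (suc y)))
    where
    open Atom A
    K = ⟨ v , (λ _ → 1) ⟩
    em = m ⊙ δ e
    co : Fin n → ℕ
    co g = m ∸ ι g
    em-over : Over G₀ em
    em-over = Over-⊙ {v = δ e} m (Over-δ e∈)
    em-min : MinZeroSum em
    em-min = Atom⇒MinZeroSum (norm-one em-over (trans (⟨⊙δ⟩ m e ι) (trans (cong (m *_) ιe) (*-identityʳ m))))
    item : ∀ {i} → i ∈ G₀ → MinZeroSum (δ i ⊕ co i ⊙ δ e)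
    item {i} i∈ = Atom⇒MinZeroSum (norm-one
      (Over-⊕ {G₀ = G₀} {δ i} {co i ⊙ δ e} (Over-δ i∈) (Over-⊙ {v = δ e} (co i) (Over-δ e∈)))
      (trans (⟨⟩-⊕ (δ i) (co i ⊙ δ e) ι) (trans (cong₂ _+_ (⟨δ⟩ i ι)
        (trans (⟨⊙δ⟩ (co i) e ι) (trans (cong (co i *_) ιe) (*-identityʳ _)))) (m+[n∸m]≡n (ι≤m i)))))
    complete : ∀ u → Over G₀ u → InL (u ⊕ ⟨ u , co ⟩ ⊙ δ e) ⟨ u , (λ _ → 1) ⟩
    complete = Seq-ind (λ u → Over G₀ u → InL (u ⊕ ⟨ u , co ⟩ ⊙ δ e) ⟨ u , (λ _ → 1) ⟩)
      (λ u z _ → InL-≐ (λ _ → refl) (sym (⟨⟩-zero (λ _ → 1) z))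
                   (InL-zero λ g → cong₂ _+_ (z g) (cong (_* δ e g) (⟨⟩-zero co z))))
      step
      where
      step : ∀ u i → 0 < u i → (Over G₀ (u ⊖ δ i) → InL (u ⊖ δ i ⊕ ⟨ u ⊖ δ i , co ⟩ ⊙ δ e) ⟨ u ⊖ δ i , (λ _ → 1) ⟩) →
             Over G₀ u → InL (u ⊕ ⟨ u , co ⟩ ⊙ δ e) ⟨ u , (λ _ → 1) ⟩
      step u i p ih o = InL-≐ pt (sym (trans (⟨⟩-⊖ (λ _ → 1) (δ≤ u i p)) (cong (_+ ⟨ u ⊖ δ i , (λ _ → 1) ⟩) (⟨δ⟩ i _))))
          (InL-⊕ (InL-atom (item (o i p))) (ih (Over-≤ {w = u ⊖ δ i} (⊖-≤ u (δ i)) o)))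
        where
        ring : ∀ d a b s E → d + a * E + (s + b * E) ≡ d + s + (a + b) * E
        ring = solve-∀
        pt : ∀ g → δ i g + co i * δ e g + (u g ∸ δ i g + ⟨ u ⊖ δ i , co ⟩ * δ e g) ≡ u g + ⟨ u , co ⟩ * δ e g
        pt g = trans (ring (δ i g) (co i) ⟨ u ⊖ δ i , co ⟩ (u g ∸ δ i g) (δ e g))
                 (cong₂ (λ s t → s + t * δ e g) (m+[n∸m]≡n (δ≤ u i p g))
                   (sym (trans (⟨⟩-⊖ co (δ≤ u i p)) (cong (_+ ⟨ u ⊖ δ i , co ⟩) (⟨δ⟩ i co)))))
    total : ⟨ v , co ⟩ + suc y * m ≡ K * m
    total = trans (cong (⟨ v , co ⟩ +_) (sym norm)) (trans (sym (⟨⟩-+ʳ v co ι))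
              (trans (⟨⟩-congʳ v λ g _ → trans (m∸n+n≡m (ι≤m g)) (sym (*-identityʳ m)))
                (trans (⟨⟩-*ʳ v m (λ _ → 1)) (*-comm m K))))
    ring₂ : ∀ v c E y m → v + c * E + y * (m * E) ≡ v + (c + y * m) * E
    ring₂ = solve-∀
    same-product : ∀ g → v g + ⟨ v , co ⟩ * δ e g + suc y * (m * δ e g) ≡ v g + K * (m * δ e g)
    same-product g = trans (ring₂ (v g) ⟨ v , co ⟩ (δ e g) (suc y) m)
      (cong (v g +_) (trans (cong (_* δ e g) total) (*-assoc K m (δ e g))))
    same-length : K + suc y ≡ 1 + K + y
    same-length = +-suc K y

  minΔ⇒ModOne : ∀ {x} → IsMinΔ G₀ x → ModOne x
  minΔ⇒ModOne mn v zero A = contradiction (Atom.pos A) λ ()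
  minΔ⇒ModOne mn v (suc y) A with minΔ∣Rel mn y (Atom⇒Rel A)
  ... | divides k eq = k , cong suc eq

  -- Bézout's identity combines the two relations into the relation `gcd a b`. No length fits
  -- between its two lengths, because all lengths of one product agree modulo that gcd.
  ModOne⇒minΔ : ∀ {v w a b} → Atom v (suc a) → Atom w (suc b) → 0 < gcd a b →
                ModOne (gcd a b) → IsMinΔ G₀ (gcd a b)
  ModOne⇒minΔ {a = a} {b} A A′ pos mod = inΔ , min
    where
    min : ∀ d → InΔG0 G₀ d → gcd a b ≤ d
    min d p@(_ , _ , _ , d>0 , _) = ∣⇒≤ {{>-nonZero d>0}} (ModOne⇒∣Δ mod p)
    rel : Rel (gcd a b)
    rel with Bézout.identity (gcd-GCD a b)
    ... | Bézout.+- x y eq = Rel-sub (trans (sym eq) (+-comm (gcd a b) _)) (Rel-* x (Atom⇒Rel A)) (Rel-* y (Atom⇒Rel A′))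
    ... | Bézout.-+ x y eq = Rel-sub (trans (sym eq) (+-comm (gcd a b) _)) (Rel-* y (Atom⇒Rel A′)) (Rel-* x (Atom⇒Rel A))
    inΔ : InΔG0 G₀ (gcd a b)
    inΔ with rel
    ... | B , o , ℓ , p , q = B , InL⇒ZeroSum p , o , pos , ℓ , p , q , gap
      where
      gap : ∀ ℓ′ → InL B ℓ′ → ℓ < ℓ′ → ℓ′ < ℓ + gcd a b → ⊥
      gap ℓ′ p′ l₁ l₂ with ModOne-lengths mod o p | ModOne-lengths mod o p′
      ... | K , eq | K′ , eq′ = >⇒∤ {{>-nonZero (m<n⇒0<n∸m l₁)}} r<gcd gcd∣r
        where
        r<gcd : ℓ′ ∸ ℓ < gcd a b
        r<gcd = +-cancelˡ-< ℓ _ _ (subst (_< ℓ + gcd a b) (sym (m+[n∸m]≡n (<⇒≤ l₁))) l₂)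
        same : K * gcd a b ≡ K′ * gcd a b + (ℓ′ ∸ ℓ)
        same = +-cancelˡ-≡ ℓ _ _ (trans (*-cancelʳ-≡ _ _ m (trans (sym eq) eq′))
          (trans (cong (_+ K′ * gcd a b) (sym (m+[n∸m]≡n (<⇒≤ l₁))))
            (trans (+-assoc ℓ _ _) (cong (ℓ +_) (+-comm (ℓ′ ∸ ℓ) _)))))
        gcd∣r : gcd a b ∣ ℓ′ ∸ ℓ
        gcd∣r = ∣m+n∣m⇒∣n {m = K′ * gcd a b} (divides K (sym same)) (n∣m*n K′)

-- Divisor chains and indexing by a generator

DivisorChain : ℕ → Set
DivisorChain n = ∀ a b → a ∣ n → b ∣ n → a ∣ b ⊎ b ∣ a

∣p^k : ∀ {p} → Prime p → ∀ k {a} → a ∣ p ^ k → ∃ λ i → a ≡ p ^ i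
∣p^k pr zero d = 0 , ∣1⇒≡1 d
∣p^k {p} pr (suc k) {a} d with p ∣? a
... | yes (divides b refl) with ∣p^k pr k {b} (*-cancelˡ-∣ p {{prime⇒nonZero pr}} (subst (_∣ p * p ^ k) (*-comm b p) d))
...   | i , eq = suc i , trans (*-comm b p) (cong (p *_) eq)
∣p^k {p} pr (suc k) {a} d | no p∤a = ∣p^k pr k (coprime-divisor cop d)
  where
  cop : Coprime a p
  cop (c∣a , c∣p) with prime⇒irreducible pr c∣p
  ... | inj₁ c≡1 = c≡1
  ... | inj₂ refl = contradiction c∣a p∤a

p^k-DivisorChain : ∀ {p} → Prime p → ∀ k → DivisorChain (p ^ k)
p^k-DivisorChain {p} pr k a b a∣ b∣ with ∣p^k pr k a∣ | ∣p^k pr k b∣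
... | i , refl | j , refl with ≤-total i j
... | inj₁ le = inj₁ (divides (p ^ (j ∸ i)) (trans (cong (p ^_) (sym (m∸n+n≡m le))) (^-distribˡ-+-* p (j ∸ i) i)))
... | inj₂ le = inj₂ (divides (p ^ (i ∸ j)) (trans (cong (p ^_) (sym (m∸n+n≡m le))) (^-distribˡ-+-* p (i ∸ j) j)))

DivisorChain-∣ : ∀ {m n} → m ∣ n → DivisorChain n → DivisorChain m
DivisorChain-∣ m∣n ch a b a∣ b∣ = ch a b (∣-trans a∣ m∣n) (∣-trans b∣ m∣n)

chain-≤⇒∣ : ∀ {n} → DivisorChain n → ∀ {a b} → 0 < a → a ∣ n → b ∣ n → a ≤ b → a ∣ b
chain-≤⇒∣ ch {a} {b} pos a∣ b∣ le with ch a b a∣ b∣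
... | inj₁ d = d
... | inj₂ d = ∣-reflexive (≤-antisym le (∣⇒≤ {{>-nonZero pos}} d))

residue-unique : ∀ {a b} x k l → a + k * x ≡ b + l * x → a < x → b < x → a ≡ b
residue-unique {a} {b} x@(suc _) k l eq a< b< =
  trans (sym (m<n⇒m%n≡m a<)) (trans (sym ([m+kn]%n≡m%n a k x)) (trans (cong (_% x) eq) (trans ([m+kn]%n≡m%n b l x) (m<n⇒m%n≡m b<))))

divide-out-gcd : ∀ h m → 0 < m → ∃ λ t → ∃₂ λ h′ m′ → h ≡ t * h′ × m ≡ t * m′ × Coprime h′ m′
divide-out-gcd h m pos = t , _∣_.quotient (gcd[m,n]∣m h m) , _∣_.quotient (gcd[m,n]∣n h m) , eh , em ,
  gcd≡1⇒coprime (*-cancelˡ-≡ _ 1 t {{t≢0}} (trans (c*gcd[m,n]≡gcd[cm,cn] t _ _)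
    (trans (sym (cong₂ gcd eh em)) (sym (*-identityʳ t)))))
  where
  t = gcd h m
  t≢0 : NonZero t
  t≢0 = ≢-nonZero λ q → >⇒≢ pos (gcd[m,n]≡0⇒n≡0 h q)
  eh = m∣n⇒n≡m*quotient (gcd[m,n]∣m h m)
  em = m∣n⇒n≡m*quotient (gcd[m,n]∣n h m)

inverse-mod : ∀ {κ m} → Coprime κ m → ∃₂ λ u z → κ * u + m ≡ 1 + m * z
inverse-mod {κ} {m} cop with coprime-Bézout cop
... | Bézout.+- x y eq = x , suc y , trans (cong (_+ m) (trans (*-comm κ x) (sym eq))) (ring y m)
  where ring : ∀ y m → 1 + y * m + m ≡ 1 + m * suc y
        ring = solve-∀
-- Here x κ is -1 modulo m, so its square is 1 and x κ x inverts κ.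
... | Bézout.-+ x y eq = x * κ * x , by (x * κ) refl
  where
  ring₁ : ∀ x κ → κ * (x * κ * x) ≡ (x * κ) * (x * κ)
  ring₁ = solve-∀
  ring₂ : ∀ w → suc w * suc w ≡ 1 + w * suc (suc w)
  ring₂ = solve-∀
  ring₃ : ∀ w y m → 1 + w * (y * m) + m ≡ 1 + m * (w * y + 1)
  ring₃ = solve-∀
  by : ∀ w → x * κ ≡ w → ∃ λ z → κ * (x * κ * x) + m ≡ 1 + m * z
  by zero q = 0 , trans (cong (_+ m) (trans (ring₁ x κ) (cong₂ _*_ q q)))
    (trans (m*n≡1⇒n≡1 y m (trans (sym eq) (cong suc q))) (sym (cong suc (*-zeroʳ m))))
  by (suc w) q = w * y + 1 ,
    trans (cong (_+ m) (trans (ring₁ x κ) (trans (cong₂ _*_ q q) (trans (ring₂ w)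
      (cong (λ s → 1 + w * s) (trans (cong suc (sym q)) eq)))))) (ring₃ w y m)

module Index (n : ℕ) (G₀ : Subset n) (τ m u : ℕ) {{_ : NonZero τ}} {{_ : NonZero m}} where

  -- The shift by `pred m` and `suc` moves the residue of `k g * u` into [1, m]: the identity
  -- receives weight m, never 0. The multiplier u will invert e / τ modulo m, which gives e the
  -- weight 1.
  k q ι : Fin n → ℕ
  k g = toℕ g / τ
  q g = (k g * u + pred m) / m
  ι g = suc ((k g * u + pred m) % m)

  ι-eq : ∀ g → ι g + m * q g ≡ k g * u + m
  ι-eq g = trans (cong (λ s → suc ((k g * u + pred m) % m + s)) (*-comm m (q g)))
    (trans (cong suc (sym (m≡m%n+[m/n]*n (k g * u + pred m) m)))
      (trans (sym (+-suc (k g * u) (pred m))) (cong (k g * u +_) (suc-pred m))))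

  ι-unique : ∀ g κ r z → toℕ g ≡ τ * κ → r < m → κ * u + m ≡ suc r + m * z → ι g ≡ suc r
  ι-unique g κ r z eq lt eq′ = cong suc (residue-unique m (q g) z
    (suc-injective (trans (cong (λ s → ι g + s) (*-comm (q g) m)) (trans (ι-eq g)
      (trans (cong (λ s → s * u + m) k≡κ) (trans eq′ (cong (suc r +_) (*-comm m z)))))))
    (m%n<n (k g * u + pred m) m) lt)
    where
    k≡κ : k g ≡ κ
    k≡κ = trans (cong (_/ τ) (trans eq (*-comm τ κ))) (m*n/n≡m κ τ)

  -- The sum of v is τ ⟨v, k⟩, and its total weight is u ⟨v, k⟩ modulo m with u a unit modulo m.
  -- Hence n divides the former exactly when m divides the latter.
  index : n ≡ τ * m → (∀ g → g ∈ G₀ → τ ∣ toℕ g) → (e : Fin n) → e ∈ G₀ →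
          (κ z : ℕ) → toℕ e ≡ τ * κ → κ * u + m ≡ 1 + m * z → Indexed n G₀ m
  index n≡ τ∣ e e∈ κ z eκ inv = record
    { ι = ι ; ι>0 = λ g → z<s ; ι≤m = λ g → m%n<n (k g * u + pred m) m
    ; zs⇒ = to ; zs⇐ = from ; e = e ; e∈ = e∈
    ; ιe = ι-unique e κ 0 z eκ (>-nonZero⁻¹ m) inv }
    where
    cop : Coprime m u
    cop {i} (i∣m , i∣u) = ∣1⇒≡1 (∣m+n∣m⇒∣n {m = m * z} (subst (i ∣_) (trans inv (+-comm 1 _))
      (∣m∣n⇒∣m+n (∣n⇒∣m*n κ i∣u) i∣m)) (∣m⇒∣m*n z i∣m))
    σ≡ : ∀ {v} → Over G₀ v → σ v ≡ τ * ⟨ v , k ⟩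
    σ≡ {v} ov = trans (⟨⟩-congʳ v λ g p → sym (m*[n/m]≡n (τ∣ g (ov g p)))) (⟨⟩-*ʳ v τ k)
    sums : ∀ v → ⟨ v , ι ⟩ + m * ⟨ v , q ⟩ ≡ u * ⟨ v , k ⟩ + m * ⟨ v , (λ _ → 1) ⟩
    sums v = trans (cong (⟨ v , ι ⟩ +_) (sym (⟨⟩-*ʳ v m q))) (trans (sym (⟨⟩-+ʳ v ι (λ g → m * q g)))
      (trans (⟨⟩-congʳ v λ g _ → trans (ι-eq g) (cong₂ _+_ (*-comm (k g) u) (sym (*-identityʳ m))))
        (trans (⟨⟩-+ʳ v (λ g → u * k g) (λ _ → m * 1)) (cong₂ _+_ (⟨⟩-*ʳ v u k) (⟨⟩-*ʳ v m (λ _ → 1))))))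
    to : ∀ {v} → Over G₀ v → ZeroSum v → m ∣ ⟨ v , ι ⟩
    to {v} ov zs = ∣m+n∣m⇒∣n {m = m * ⟨ v , q ⟩} (subst (m ∣_) (trans (sym (sums v)) (+-comm ⟨ v , ι ⟩ _))
        (∣m∣n⇒∣m+n (∣n⇒∣m*n u m∣k) (m∣m*n ⟨ v , (λ _ → 1) ⟩))) (m∣m*n _)
      where
      m∣k : m ∣ ⟨ v , k ⟩
      m∣k = *-cancelˡ-∣ τ (subst₂ _∣_ n≡ (σ≡ ov) zs)
    from : ∀ {v} → Over G₀ v → m ∣ ⟨ v , ι ⟩ → ZeroSum v
    from {v} ov d = subst₂ _∣_ (sym n≡) (sym (σ≡ ov)) (*-monoʳ-∣ τ (coprime-divisor cop
      (∣m+n∣m⇒∣n {m = m * ⟨ v , (λ _ → 1) ⟩} (subst (m ∣_) (trans (sums v) (+-comm (u * ⟨ v , k ⟩) _))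
        (∣m∣n⇒∣m+n d (m∣m*n _))) (m∣m*n _))))

-- An element with least gcd(g, n) is chosen; along the divisor chain this gcd divides all the
-- others, so the subgroup it generates contains G₀. Without the chain this fails: neither member of
-- {2, 3} generates ℤ/6ℤ.
generated : ∀ {n} → DivisorChain n → 0 < n → (G₀ : Subset n) → (∃ λ g → g ∈ G₀) →
            ∃ λ m → m ∣ n × Indexed n G₀ m
generated {n} ch n>0 G₀ (g₀ , g₀∈) with argmin (_∈? G₀) (λ g → gcd (toℕ g) n)
... | inj₂ none = contradiction g₀∈ (none g₀)
... | inj₁ (e , e∈ , least) = m , divides τ n≡ , I
  where
  τ = gcd (toℕ e) n
  m = _∣_.quotient (gcd[m,n]∣n (toℕ e) n)
  κ = _∣_.quotient (gcd[m,n]∣m (toℕ e) n)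
  n≡ : n ≡ τ * m
  n≡ = m∣n⇒n≡m*quotient (gcd[m,n]∣n (toℕ e) n)
  e≡ : toℕ e ≡ τ * κ
  e≡ = m∣n⇒n≡m*quotient (gcd[m,n]∣m (toℕ e) n)
  instance
    τ≢0 : NonZero τ
    τ≢0 = ≢-nonZero λ q → >⇒≢ n>0 (gcd[m,n]≡0⇒n≡0 (toℕ e) q)
    m≢0 : NonZero m
    m≢0 = ≢-nonZero λ q → >⇒≢ n>0 (trans n≡ (trans (cong (τ *_) q) (*-zeroʳ τ)))
  cop : Coprime κ m
  cop = gcd≡1⇒coprime (*-cancelˡ-≡ _ 1 τ (trans (c*gcd[m,n]≡gcd[cm,cn] τ κ m)
          (trans (sym (cong₂ gcd e≡ n≡)) (sym (*-identityʳ τ)))))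
  τ∣ : ∀ g → g ∈ G₀ → τ ∣ toℕ g
  τ∣ g g∈ = ∣-trans (chain-≤⇒∣ ch (>-nonZero⁻¹ τ) (gcd[m,n]∣n (toℕ e) n) (gcd[m,n]∣n (toℕ g) n) (least g g∈))
                    (gcd[m,n]∣m (toℕ g) n)
  I : Indexed n G₀ m
  I with inverse-mod cop
  ... | u , z , inv = Index.index n G₀ τ m u n≡ τ∣ e e∈ κ z e≡ inv

-- Atoms over two elements

module PairAtoms {n : ℕ} {G₀ : Subset n} {m : ℕ} (I : Indexed n G₀ m) where
  open Indexed I
  open Norm I

  pair-atom : ∀ {x y} a b N → x ∈ G₀ → y ∈ G₀ → a * ι x + b * ι y ≡ N * m → 0 < N →
              (∀ i j i′ j′ M M′ → i + i′ ≡ a → j + j′ ≡ b → i * ι x + j * ι y ≡ M * m →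
                 i′ * ι x + j′ * ι y ≡ M′ * m → M ≡ 0 ⊎ M′ ≡ 0) →
              Atom (pair a x b y) N
  pair-atom {x} {y} a b N x∈ y∈ total N>0 split = record
    { over = Over-pair a b x∈ y∈ ; norm = trans (⟨pair⟩ a x b y ι) total ; pos = N>0 ; irr = irr′ }
    where
    irr′ : ∀ w M → w ≤ₛ pair a x b y → ⟨ w , ι ⟩ ≡ M * m → M ≡ 0 ⊎ M ≡ N
    irr′ w M le eq with ≤pair le
    ... | i , j , i≤ , j≤ , s with split i j (a ∸ i) (b ∸ j) M (N ∸ M) (m+[n∸m]≡n i≤) (m+[n∸m]≡n j≤) part rest
      where
      part : i * ι x + j * ι y ≡ M * m
      part = trans (sym (s ι)) eq
      ring : ∀ i i′ j j′ X Y → i * X + j * Y + (i′ * X + j′ * Y) ≡ (i + i′) * X + (j + j′) * Y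
      ring = solve-∀
      whole : M * m + ((a ∸ i) * ι x + (b ∸ j) * ι y) ≡ N * m
      whole = trans (cong (_+ ((a ∸ i) * ι x + (b ∸ j) * ι y)) (sym part)) (trans (ring i (a ∸ i) j (b ∸ j) (ι x) (ι y))
        (trans (cong₂ (λ k l → k * ι x + l * ι y) (m+[n∸m]≡n i≤) (m+[n∸m]≡n j≤)) total))
      rest : (a ∸ i) * ι x + (b ∸ j) * ι y ≡ (N ∸ M) * m
      rest = trans (sym (m+n∸m≡n (M * m) _)) (trans (cong (_∸ M * m) whole) (sym (*-distribʳ-∸ m N M)))
    ...   | inj₁ M≡0 = inj₁ M≡0
    ...   | inj₂ N∸M≡0 = inj₂ (≤-antisym M≤N (m∸n≡0⇒m≤n N∸M≡0))
      where
      M≤N : M ≤ N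
      M≤N = *-cancelʳ-≤ M N m (≤-trans (≤-reflexive (sym eq)) (≤-trans (⟨⟩-monoˡ ι le)
              (≤-reflexive (trans (⟨pair⟩ a x b y ι) total))))

  -- In two complementary zero-sum divisors the exponents of y are multiples of b with sum b, so one
  -- divisor has no y, and x^a has no nonempty zero-sum divisor.
  indivisible-atom : ∀ {x y} a b N → x ∈ G₀ → y ∈ G₀ → a * ι x + b * ι y ≡ N * m → 0 < N →
                     (∀ i j M → i ≤ a → i * ι x + j * ι y ≡ M * m → b ∣ j) →
                     (∀ i M → i ≤ a → i * ι x ≡ M * m → M ≡ 0) →
                     Atom (pair a x b y) N
  indivisible-atom {x} {y} a b N x∈ y∈ total N>0 div none = pair-atom a b N x∈ y∈ total N>0 split
    where
    no-y : ∀ i i′ j M → i + i′ ≡ a → i * ι x + j * ι y ≡ M * m → j ≡ 0 → M ≡ 0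
    no-y i i′ _ M s eq refl = none i M (≤-trans (m≤m+n i i′) (≤-reflexive s)) (trans (sym (+-identityʳ _)) eq)
    split : ∀ i j i′ j′ M M′ → i + i′ ≡ a → j + j′ ≡ b → i * ι x + j * ι y ≡ M * m →
            i′ * ι x + j′ * ι y ≡ M′ * m → M ≡ 0 ⊎ M′ ≡ 0
    split i zero i′ j′ M M′ s₁ s₂ e₁ e₂ = inj₁ (no-y i i′ 0 M s₁ e₁ refl)
    split i j@(suc _) i′ j′ M M′ s₁ s₂ e₁ e₂ =
      inj₂ (no-y i′ i j′ M′ (trans (+-comm i′ i) s₁) e₂ (n≤0⇒n≡0 (+-cancelˡ-≤ j j′ 0
        (≤-trans (≤-reflexive s₂) (≤-trans (∣⇒≤ (div i j M (≤-trans (m≤m+n i i′) (≤-reflexive s₁)) e₁)) (≤-reflexive (sym (+-identityʳ j))))))))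

  -- x^α y^(μ(gc+1)) is the first lattice vertex beyond x^(s / ι x) y^(μ c): every zero-sum divisor of norm M > 0
  -- uses more than M c blocks of μ copies of y.
  vertex-atom : ∀ {x y} μ c s α g → x ∈ G₀ → y ∈ G₀ → 0 < μ → m ≡ c * (μ * ι y) + s →
                α * ι x < s → α * ι x + μ * ι y ≡ g * s →
                (∀ i j M → i * ι x + j * ι y ≡ M * m → μ ∣ j) →
                Atom (pair α x (μ * (g * c + 1)) y) g
  vertex-atom {x} {y} μ@(suc _) c s α g x∈ y∈ μ>0 m≡ α< gs div = pair-atom α b g x∈ y∈ total g>0 split
    where
    H = μ * ι y
    b = μ * (g * c + 1)
    H>0 : 0 < H
    H>0 = *-mono-< {0} {μ} z<s (ι>0 y)
    g>0 : 0 < g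
    g>0 = n≢0⇒n>0 λ g≡0 → >⇒≢ H>0 (m+n≡0⇒n≡0 (α * ι x) (trans gs (cong (_* s) g≡0)))
    total : α * ι x + b * ι y ≡ g * m
    total = trans (ring₁ (α * ι x) μ g c (ι y)) (trans (cong (_+ g * (c * (μ * ι y))) gs)
            (trans (ring₂ g s (c * (μ * ι y))) (cong (g *_) (sym m≡))))
      where
      ring₁ : ∀ a μ g c Y → a + μ * (g * c + 1) * Y ≡ a + μ * Y + g * (c * (μ * Y))
      ring₁ = solve-∀
      ring₂ : ∀ g s k → g * s + g * k ≡ g * (k + s)
      ring₂ = solve-∀
    -- The copies of x weigh less than s, so k ≤ (M + 1) c would leave a weight below (M + 1)(c H +
    -- s).
    blocks : ∀ i k M → i ≤ α → i * ι x + k * μ * ι y ≡ suc M * m → suc M * c < k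
    blocks i k M i≤ eq = ≰⇒> λ k≤ → <⇒≱
      (≤-trans (+-mono-<-≤ (<-≤-trans (≤-<-trans (*-monoˡ-≤ (ι x) i≤) α<) (m≤m+n s (M * s))) (*-monoˡ-≤ H k≤))
        (≤-reflexive (trans (ring s M c H) (cong (suc M *_) (sym m≡)))))
      (≤-reflexive (trans (sym eq) (cong (i * ι x +_) (*-assoc k μ (ι y)))))
      where
      ring : ∀ s M c H → s + M * s + suc M * c * H ≡ suc M * (c * H + s)
      ring = solve-∀
    split : ∀ i j i′ j′ M M′ → i + i′ ≡ α → j + j′ ≡ b → i * ι x + j * ι y ≡ M * m →
            i′ * ι x + j′ * ι y ≡ M′ * m → M ≡ 0 ⊎ M′ ≡ 0
    split i j i′ j′ zero M′ s₁ s₂ e₁ e₂ = inj₁ refl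
    split i j i′ j′ (suc M) zero s₁ s₂ e₁ e₂ = inj₂ refl
    split i j i′ j′ (suc M) (suc M′) s₁ s₂ e₁ e₂ with div i j (suc M) e₁ | div i′ j′ (suc M′) e₂
    ... | divides k refl | divides k′ refl = contradiction too-many (<⇒≱ (≤-reflexive (trans (cong suc kk) (ring₂ g c))))
      where
      norms : suc M + suc M′ ≡ g
      norms = *-cancelʳ-≡ _ _ m (trans (*-distribʳ-+ m (suc M) (suc M′)) (trans (cong₂ _+_ (sym e₁) (sym e₂))
        (trans (ring₁ i i′ (k * μ) (k′ * μ) (ι x) (ι y)) (trans (cong₂ (λ p q → p * ι x + q * ι y) s₁ s₂) total))))
        where
        ring₁ : ∀ i i′ j j′ X Y → i * X + j * Y + (i′ * X + j′ * Y) ≡ (i + i′) * X + (j + j′) * Y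
        ring₁ = solve-∀
      kk : k + k′ ≡ g * c + 1
      kk = *-cancelʳ-≡ _ _ μ (trans (*-distribʳ-+ μ k k′) (trans s₂ (*-comm μ (g * c + 1))))
      ring₂ : ∀ g c → suc (g * c + 1) ≡ g * c + 2
      ring₂ = solve-∀
      ring₃ : ∀ a b c → suc (a * c) + suc (b * c) ≡ (a + b) * c + 2
      ring₃ = solve-∀
      -- Each part needs at least one block more than c times its norm, two in all, while the
      -- sequence has a surplus of only one.
      too-many : g * c + 2 ≤ k + k′
      too-many = ≤-trans (≤-reflexive (sym (trans (ring₃ (suc M) (suc M′) c) (cong (λ z → z * c + 2) norms))))
        (+-mono-≤ (blocks i k M (≤-trans (m≤m+n i i′) (≤-reflexive s₁)) e₁)
                  (blocks i′ k′ M′ (≤-trans (m≤n+m i′ i) (≤-reflexive s₁)) e₂))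

  -- Modulo ι x, a divisor of m, both the copies of x and the norm vanish; this leaves d′ ∣ h′ j.
  blocks : ∀ {x y} t d′ q h′ → ι x ≡ t * d′ → ι y ≡ t * h′ → m ≡ t * d′ * q → Coprime d′ h′ →
           ∀ i j M → i * ι x + j * ι y ≡ M * m → d′ ∣ j
  blocks {x} {y} t d′ q h′ ιx ιy m≡ cop i j M eq = coprime-divisor cop (*-cancelˡ-∣ t {{t≢0}}
      (subst (t * d′ ∣_) (trans (cong (j *_) ιy) (ring j t h′))
        (∣m+n∣m⇒∣n (subst (t * d′ ∣_) (sym eq) (∣n⇒∣m*n M (subst (t * d′ ∣_) (sym m≡) (m∣m*n q))))
                   (∣n⇒∣m*n i (∣-reflexive (sym ιx))))))
    where
    t≢0 : NonZero t
    t≢0 = m*n≢0⇒m≢0 t {{subst NonZero ιx (>-nonZero (ι>0 x))}}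
    ring : ∀ j t h → j * (t * h) ≡ t * (h * j)
    ring = solve-∀

  -- With ι x = d = t d′, ι y = t h′ and m = d q: here the y occur only in blocks of d′.
  block-atom : ∀ {x y} t d′ q h′ r b → x ∈ G₀ → y ∈ G₀ → 0 < d′ → ι x ≡ t * d′ → ι y ≡ t * h′ → m ≡ t * d′ * q →
               Coprime d′ h′ → r < q → h′ ≡ b * q + suc r →
               Atom (pair (q ∸ suc r) x d′ y) (suc b)
  block-atom {x} {y} t d′ q h′ r b x∈ y∈ d′>0 ιx ιy m≡ cop r<q h≡ =
    indivisible-atom (q ∸ suc r) d′ (suc b) x∈ y∈ total z<s (λ i j M _ → blocks t d′ q h′ ιx ιy m≡ cop i j M) none
    where
    td≢0 : NonZero (t * d′)
    td≢0 = subst NonZero ιx (>-nonZero (ι>0 x))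
    instance
      t≢0 : NonZero t
      t≢0 = m*n≢0⇒m≢0 t {{td≢0}}
    total : (q ∸ suc r) * ι x + d′ * ι y ≡ suc b * m
    total = trans (cong₂ (λ X Y → (q ∸ suc r) * X + d′ * Y) ιx (trans ιy (cong (t *_) h≡)))
      (trans (ring (q ∸ suc r) t d′ b q (suc r)) (trans (cong (λ k → t * d′ * (k + b * q)) (m∸n+n≡m r<q))
        (trans (ring₂ t d′ q b) (cong (suc b *_) (sym m≡)))))
      where
      ring : ∀ k t d b q r → k * (t * d) + d * (t * (b * q + r)) ≡ t * d * (k + r + b * q)
      ring = solve-∀
      ring₂ : ∀ t d q b → t * d * (q + b * q) ≡ suc b * (t * d * q)
      ring₂ = solve-∀
    none : ∀ i M → i ≤ q ∸ suc r → i * ι x ≡ M * m → M ≡ 0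
    none i zero le eq = refl
    none i (suc M) le eq = contradiction (≤-trans (m≤m+n q (M * q)) (≤-reflexive (sym i≡)))
        (<⇒≱ (≤-<-trans le (∸-monoʳ-< {q} z<s r<q)))
      where
      i≡ : i ≡ suc M * q
      i≡ = *-cancelʳ-≡ i (suc M * q) (t * d′) {{td≢0}} (trans (cong (i *_) (sym ιx)) (trans eq
        (trans (cong (suc M *_) (trans m≡ (*-comm (t * d′) q))) (sym (*-assoc (suc M) q (t * d′))))))

  -- The element y has order m′, so this is its full power; writing it with e to the exponent 0
  -- brings it into the form of `indivisible-atom`.
  power-atom : ∀ {y} t h′ m′ → y ∈ G₀ → ι y ≡ t * h′ → m ≡ t * m′ → Coprime m′ h′ → Atom (pair 0 e m′ y) h′
  power-atom {y} t h′ m′ y∈ ιy m≡ cop = indivisible-atom 0 m′ h′ e∈ y∈ total h′>0 div none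
    where
    instance
      t≢0 : NonZero t
      t≢0 = m*n≢0⇒m≢0 t {{subst NonZero m≡ m≢0}}
      th≢0 : NonZero (t * h′)
      th≢0 = subst NonZero ιy (>-nonZero (ι>0 y))
    h′>0 : 0 < h′
    h′>0 = >-nonZero⁻¹ h′ {{m*n≢0⇒n≢0 t}}
    ring : ∀ t h m → m * (t * h) ≡ h * (t * m)
    ring = solve-∀
    total : m′ * ι y ≡ h′ * m
    total = trans (cong (m′ *_) ιy) (trans (ring t h′ m′) (cong (h′ *_) (sym m≡)))
    div : ∀ i j M → i ≤ 0 → i * ι e + j * ι y ≡ M * m → m′ ∣ j
    div zero j M _ eq = coprime-divisor cop (*-cancelˡ-∣ t (subst₂ _∣_ m≡ (trans (cong (j *_) ιy) (ring₂ j t h′)) (divides M eq)))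
      where
      ring₂ : ∀ j t h → j * (t * h) ≡ t * (h * j)
      ring₂ = solve-∀
    none : ∀ i M → i ≤ 0 → i * ι e ≡ M * m → M ≡ 0
    none zero zero _ _ = refl
    none zero (suc M) _ eq = contradiction eq (<⇒≢ (<-≤-trans 0<m (m≤m+n m (M * m))))

-- Norms of all atoms modulo gcd A b

data Class : Set where
  small large high : Class

keep : Class → Class → ℕ → ℕ
keep small small k = k
keep large large k = k
keep high high k = k
keep _ _ k = 0

keep-≤ : ∀ C D k → keep C D k ≤ k
keep-≤ small small k = ≤-refl
keep-≤ small large k = z≤n
keep-≤ small high k = z≤n
keep-≤ large small k = z≤n
keep-≤ large large k = ≤-refl
keep-≤ large high k = z≤n
keep-≤ high small k = z≤n
keep-≤ high large k = z≤n
keep-≤ high high k = ≤-refl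

keep-supp : ∀ C D k → 0 < keep C D k → D ≡ C
keep-supp small small k _ = refl
keep-supp large large k _ = refl
keep-supp high high k _ = refl

keep-sum : ∀ D k → keep small D k + keep large D k + keep high D k ≡ k
keep-sum small k = trans (+-identityʳ _) (+-identityʳ k)
keep-sum large k = +-identityʳ k
keep-sum high k = refl

-- The relevant weights in [1, m]: with h = t h′ and m = c h + t c₁, they are the divisors of m dividing
-- t c₁, the divisors of m divisible by t d′, and certain multiples j h of h.
record Shape (m : ℕ) : Set where
  field
    t c c₁ A b d′ q : ℕ
    t>0  : 0 < t
    c>0  : 0 < c
    c₁>0 : 0 < c₁
  h′ = 1 + A * c₁
  m′ = c * h′ + c₁
  field
    m≡   : m ≡ t * m′
    m′≡  : m′ ≡ d′ * q
    h′≡  : h′ ≡ 1 + b * q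

  -- The identity h′ (1 + A c) = A m′ + 1 shows an inverse of h′ modulo m′, and d′ divides m′.
  h′-coprime : Coprime d′ h′
  h′-coprime {i} (i∣d , i∣h) = ∣1⇒≡1 (∣m+n∣m⇒∣n {m = A * (d′ * q)}
      (subst (i ∣_) eq (∣m⇒∣m*n (1 + A * c) i∣h)) (∣n⇒∣m*n A (∣m⇒∣m*n q i∣d)))
    where
    ring : ∀ A c c₁ → (1 + A * c₁) * (1 + A * c) ≡ A * (c * (1 + A * c₁) + c₁) + 1
    ring = solve-∀
    eq : h′ * (1 + A * c) ≡ A * (d′ * q) + 1
    eq = trans (ring A c c₁) (cong (λ s → A * s + 1) m′≡)

  -- For `high`, the condition j ∣ c lets multipliers be collected to exactly c, and j ∣ d′ to any
  -- available multiple of d′.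
  Fits : Class → ℕ → ℕ → Set
  Fits small w j = w ∣ m × w ∣ t * c₁
  Fits large w j = w ∣ m × t * d′ ∣ w
  Fits high  w j = w ≡ t * h′ * j × j ∣ c × j ∣ d′

module _ {n : ℕ} {G₀ : Subset n} {m : ℕ} (I : Indexed n G₀ m) (chain : DivisorChain m) (S : Shape m) where
  open Indexed I
  open Norm I
  open Shape S

  -- If the divisor weights reach m, or the small ones reach t c₁ while J reaches c, a norm-one
  -- divisor can be filled. If the divisor weights stay below m and J < c, the total weight is below
  -- 2m. In the remaining case J is compared with the solution J₀ of a congruence, and N is 1 + l A,
  -- or 1 + l A minus a multiple of b.
  Shape⇒ModOne : (cls : Fin n → Class) (j : Fin n → ℕ) → (∀ g → g ∈ G₀ → Fits (cls g) (ι g) (j g)) →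
                 ∀ X → X ∣ A → X ∣ b → ModOne X
  Shape⇒ModOne cls j fits X X∣A X∣b v N At = main
    where
    open Atom At
    only : Class → Seq n
    only C g = keep C (cls g) (v g)
    vS = only small
    vL = only large
    vH = only high

    supp : ∀ C g → 0 < only C g → Fits C (ι g) (j g)
    supp C g p = subst (λ D → Fits D (ι g) (j g)) (keep-supp C (cls g) (v g) p)
                   (fits g (over g (≤-trans p (keep-≤ C (cls g) (v g)))))

    parts : vS ⊕ vL ⊕ vH ≐ v
    parts g = keep-sum (cls g) (v g)

    J uS uL : ℕ
    J = ⟨ vH , j ⟩
    uS = ⟨ vS , ι ⟩
    uL = ⟨ vL , ι ⟩

    high-sum : ∀ w → w ≤ₛ vH → ⟨ w , ι ⟩ ≡ t * h′ * ⟨ w , j ⟩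
    high-sum w le = trans (⟨⟩-congʳ w λ g p → proj₁ (supp high g (≤-trans p (le g)))) (⟨⟩-*ʳ w (t * h′) j)

    total : uS + uL + t * h′ * J ≡ N * m
    total = trans (cong₂ _+_ (sym (⟨⟩-⊕ vS vL ι)) (sym (high-sum vH λ _ → ≤-refl)))
      (trans (sym (⟨⟩-⊕ (vS ⊕ vL) vH ι)) (trans (⟨⟩-congˡ ι parts) norm))

    small-high-≤ : ∀ {w₁ w₂} → w₁ ≤ₛ vS → w₂ ≤ₛ vH → (w₁ ⊕ w₂) ≤ₛ v
    small-high-≤ le₁ le₂ g = ≤-trans (+-mono-≤ (le₁ g) (le₂ g))
      (≤-trans (+-monoˡ-≤ (vH g) (m≤m+n (vS g) (vL g))) (≤-reflexive (parts g)))

    result-one : N ≡ 1 → ∃ λ k → N ≡ suc (k * X)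
    result-one e = 0 , e

    result : ∀ N₁ → N ≡ suc N₁ → X ∣ N₁ → ∃ λ k → N ≡ suc (k * X)
    result N₁ e (divides k eq) = k , trans e (cong suc eq)

    j>0 : ∀ g → 0 < vH g → 0 < j g
    j>0 g p with j g | proj₁ (supp high g p)
    ... | zero  | eq = contradiction (trans eq (*-zeroʳ (t * h′))) (>⇒≢ (ι>0 g))
    ... | suc _ | eq = z<s

    d′∣m : d′ ∣ m
    d′∣m = subst (d′ ∣_) (sym (trans m≡ (cong (t *_) m′≡))) (∣n⇒∣m*n t (m∣m*n q))

    fill-high : ∀ R → (∀ g → 0 < vH g → j g ∣ R) → R ≤ J → Σ (Seq n) λ w → w ≤ₛ vH × ⟨ w , j ⟩ ≡ R
    fill-high R div le = fill j R vH (λ g p → j>0 g p , div g p)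
      (λ g h p q → chain (j g) (j h) (∣-trans (proj₂ (proj₂ (supp high g p))) d′∣m)
                                     (∣-trans (proj₂ (proj₂ (supp high h q))) d′∣m)) le

    m-split : t * c₁ + t * h′ * c ≡ m
    m-split = trans (ring t c₁ h′ c) (sym m≡)
      where ring : ∀ t c₁ h c → t * c₁ + t * h * c ≡ t * (c * h + c₁)
            ring = solve-∀

    main : ∃ λ k → N ≡ suc (k * X)
    main with m ≤? uS + uL
    ... | yes m≤ with fill ι m (vS ⊕ vL) div ch (subst (m ≤_) (sym (⟨⟩-⊕ vS vL ι)) m≤)
      where
      div′ : ∀ g → 0 < (vS ⊕ vL) g → ι g ∣ m
      div′ g p with vS g in eq
      ... | suc _ = proj₁ (supp small g (subst (0 <_) (sym eq) z<s))
      ... | zero = proj₁ (supp large g p)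
      div : ∀ g → 0 < (vS ⊕ vL) g → 0 < ι g × ι g ∣ m
      div g p = ι>0 g , div′ g p
      ch : ∀ g h → 0 < (vS ⊕ vL) g → 0 < (vS ⊕ vL) h → ι g ∣ ι h ⊎ ι h ∣ ι g
      ch g h p q = chain (ι g) (ι h) (div′ g p) (div′ h q)
    ...   | w , le , eq = result-one (Atom-sub 1 At
              (λ g → ≤-trans (le g) (≤-trans (m≤m+n _ (vH g)) (≤-reflexive (parts g))))
              z<s (trans eq (sym (*-identityˡ m))))
    main | no m≰ with c ≤? J
    ... | no c≰J = result-one (≤-antisym (s≤s⁻¹ (*-cancelʳ-< m N 2 N<2)) pos)
      where
      uH≤m : t * h′ * J ≤ m
      uH≤m = ≤-trans (*-monoʳ-≤ (t * h′) (<⇒≤ (≰⇒> c≰J))) (≤-trans (m≤n+m _ (t * c₁)) (≤-reflexive m-split))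
      N<2 : N * m < 2 * m
      N<2 = subst (_< 2 * m) total (≤-trans (+-mono-<-≤ (≰⇒> m≰) uH≤m) (≤-reflexive (cong (m +_) (sym (+-identityʳ m)))))
    ... | yes c≤J with t * c₁ ≤? uS
    ...   | yes s≤ with fill ι (t * c₁) vS (λ g p → ι>0 g , proj₂ (supp small g p))
                          (λ g h p q → chain (ι g) (ι h) (proj₁ (supp small g p)) (proj₁ (supp small h q))) s≤
                      | fill-high c (λ g p → proj₁ (proj₂ (supp high g p))) c≤J
    ...     | w₁ , le₁ , eq₁ | w₂ , le₂ , eq₂ = result-one (Atom-sub 1 At (small-high-≤ le₁ le₂) z<s
                (trans (⟨⟩-⊕ w₁ w₂ ι) (trans (cong₂ _+_ eq₁ (trans (high-sum w₂ le₂) (cong (t * h′ *_) eq₂)))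
                  (trans m-split (sym (*-identityˡ m))))))
    main | no m≰ | yes c≤J | no s≰ = many uL≡ uS≡
      where
      td∣uL : t * d′ ∣ uL
      td∣uL = ⟨⟩-∣ vL ι (t * d′) λ g p → proj₂ (supp large g p)
      uL≡ : ∃ λ V → uL ≡ t * (d′ * V)
      uL≡ = _∣_.quotient td∣uL , trans (m∣n⇒n≡m*quotient td∣uL) (*-assoc t d′ _)
      t∣uS : t ∣ uS
      t∣uS = ∣m+n∣m⇒∣n {m = uL + t * h′ * J} (subst (t ∣_) (trans (sym total) (trans (+-assoc uS uL _) (+-comm uS _)))
                 (∣n⇒∣m*n N (subst (t ∣_) (sym m≡) (m∣m*n m′))))
               (∣m∣n⇒∣m+n (m*n∣⇒m∣ t d′ td∣uL) (∣m⇒∣m*n J (m∣m*n h′)))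
      uS≡ : ∃ λ u′ → uS ≡ t * u′
      uS≡ = _∣_.quotient t∣uS , m∣n⇒n≡m*quotient t∣uS
      instance
        t≢0 : NonZero t
        t≢0 = >-nonZero t>0
      dq≢0 : NonZero (d′ * q)
      dq≢0 = subst NonZero m′≡ (>-nonZero (≤-trans c₁>0 (m≤n+m c₁ (c * h′))))
      instance
        d′≢0 : NonZero d′
        d′≢0 = m*n≢0⇒m≢0 d′ {{dq≢0}}
        q≢0 : NonZero q
        q≢0 = m*n≢0⇒n≢0 d′ {{dq≢0}}
      many : (∃ λ V → uL ≡ t * (d′ * V)) → (∃ λ u′ → uS ≡ t * u′) → ∃ λ k → N ≡ suc (k * X)
      many (V , uL≡) (u′ , uS≡) with c₁ ∸ u′ in l≡
      ... | zero = contradiction (≤-trans (*-monoʳ-≤ t (m∸n≡0⇒m≤n l≡)) (≤-reflexive (sym uS≡))) s≰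
      ... | l@(suc _) = by-J
        where
        u′≤ : u′ ≤ c₁
        u′≤ = <⇒≤ (*-cancelˡ-< t u′ c₁ (subst (_< t * c₁) uS≡ (≰⇒> s≰)))
        c₁≡ : c₁ ≡ u′ + l
        c₁≡ = trans (sym (m+[n∸m]≡n u′≤)) (cong (u′ +_) l≡)
        -- Modulo m′, the product h′ c is -c₁ and 1 + A c inverts h′, so m′ divides u′ + h′ J₀; the
        -- quotient is 1 + l A.
        J₀ = c + l * (1 + A * c)
        reduced : u′ + h′ * J + d′ * V ≡ d′ * q * N
        reduced = *-cancelˡ-≡ _ _ t (trans (ring₁ t u′ h′ J (d′ * V))
          (trans (cong₂ (λ x y → x + y + t * h′ * J) (sym uS≡) (sym uL≡))
            (trans total (trans (cong (N *_) (trans m≡ (cong (t *_) m′≡))) (ring₂ N t (d′ * q))))))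
          where
          ring₁ : ∀ t u h J w → t * (u + h * J + w) ≡ t * u + t * w + t * h * J
          ring₁ = solve-∀
          ring₂ : ∀ N t w → N * (t * w) ≡ t * (w * N)
          ring₂ = solve-∀
        at-J₀ : u′ + h′ * J₀ ≡ d′ * q * (1 + l * A)
        at-J₀ = trans (cong (λ x → u′ + (1 + A * x) * J₀) c₁≡) (trans (ring u′ A l c)
          (cong (_* (1 + l * A)) (trans (cong (λ x → c * (1 + A * x) + x) (sym c₁≡)) m′≡)))
          where
          ring : ∀ u A l c → u + (1 + A * (u + l)) * (c + l * (1 + A * c)) ≡
                             (c * (1 + A * (u + l)) + (u + l)) * (1 + l * A)
          ring = solve-∀
        V<q : V < q
        V<q = *-cancelˡ-< (t * d′) V q (≤-trans (s≤s (≤-reflexive (trans (*-assoc t d′ V) (sym uL≡))))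
                (≤-trans (s≤s (m≤n+m uL uS)) (≤-trans (≰⇒> m≰)
                  (≤-reflexive (trans m≡ (trans (cong (t *_) m′≡) (sym (*-assoc t d′ q))))))))
        by-J : ∃ λ k → N ≡ suc (k * X)
        by-J with J₀ ≤? J
        ... | yes J₀≤J with fill-high (J ∸ J₀) (λ g p → ∣-trans (proj₂ (proj₂ (supp high g p))) d′∣D) (m∸n≤m J J₀)
          where
          D = J ∸ J₀
          sum-D : d′ * q * (1 + l * A) + (h′ * D + d′ * V) ≡ d′ * q * N
          sum-D = trans (cong (_+ (h′ * D + d′ * V)) (sym at-J₀)) (trans (ring u′ h′ J₀ D (d′ * V))
            (trans (cong (λ x → u′ + h′ * x + d′ * V) (m+[n∸m]≡n J₀≤J)) reduced))
            where
            ring : ∀ u h J D w → u + h * J + (h * D + w) ≡ u + h * (J + D) + w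
            ring = solve-∀
          d′∣hD+dV : d′ ∣ h′ * D + d′ * V
          d′∣hD+dV = ∣m+n∣m⇒∣n {m = d′ * q * (1 + l * A)} (subst (d′ ∣_) (sym sum-D) (∣m⇒∣m*n N (m∣m*n q)))
                       (∣m⇒∣m*n (1 + l * A) (m∣m*n q))
          d′∣D : d′ ∣ D
          d′∣D = coprime-divisor h′-coprime
            (∣m+n∣m⇒∣n {m = d′ * V} (subst (d′ ∣_) (+-comm (h′ * D) _) d′∣hD+dV) (m∣m*n V))
        ...   | w , le , eq = result (l * A) (Atom-sub (1 + l * A) At
                  (small-high-≤ {vS} {vH ⊖ w} (λ _ → ≤-refl) (⊖-≤ vH w)) z<s sum-w) (∣n⇒∣m*n l X∣A)
          where
          rest : ⟨ vH ⊖ w , j ⟩ ≡ J₀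
          rest = +-cancelˡ-≡ (J ∸ J₀) _ _ (trans (cong (_+ ⟨ vH ⊖ w , j ⟩) (sym eq))
                   (trans (sym (⟨⟩-⊖ j le)) (sym (m∸n+n≡m J₀≤J))))
          ring : ∀ t u h J → t * u + t * h * J ≡ t * (u + h * J)
          ring = solve-∀
          ring₂ : ∀ t w l → t * (w * l) ≡ l * (t * w)
          ring₂ = solve-∀
          sum-w : ⟨ vS ⊕ (vH ⊖ w) , ι ⟩ ≡ (1 + l * A) * m
          sum-w = trans (⟨⟩-⊕ vS (vH ⊖ w) ι) (trans (cong₂ _+_ uS≡ (trans (high-sum (vH ⊖ w) (⊖-≤ vH w)) (cong (t * h′ *_) rest)))
            (trans (ring t u′ h′ J₀) (trans (cong (t *_) at-J₀) (trans (ring₂ t (d′ * q) (1 + l * A))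
              (cong ((1 + l * A) *_) (sym (trans m≡ (cong (t *_) m′≡))))))))
        -- The deficit is d′ T with T < q. Since h′ = 1 + b q, the weights give T + (N + b T) q = V
        -- + (1 + l A) q, and the remainders T and V below q agree.
        by-J | no J₀≰J = below d′∣D
          where
          D = J₀ ∸ J
          J+D : J + D ≡ J₀
          J+D = m+[n∸m]≡n (<⇒≤ (≰⇒> J₀≰J))
          sum-D : d′ * q * N + h′ * D ≡ d′ * q * (1 + l * A) + d′ * V
          sum-D = trans (cong (_+ h′ * D) (sym reduced)) (trans (ring u′ h′ J D (d′ * V))
            (cong (_+ d′ * V) (trans (cong (λ x → u′ + h′ * x) J+D) at-J₀)))
            where
            ring : ∀ u h J D w → u + h * J + w + h * D ≡ u + h * (J + D) + w
            ring = solve-∀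
          d′∣D : d′ ∣ D
          d′∣D = coprime-divisor h′-coprime (∣m+n∣m⇒∣n {m = d′ * q * N} (subst (d′ ∣_) (sym sum-D)
            (∣m∣n⇒∣m+n (∣m⇒∣m*n (1 + l * A) (m∣m*n q)) (m∣m*n V))) (∣m⇒∣m*n N (m∣m*n q)))
          D≤ : D ≤ l * (1 + A * c)
          D≤ = +-cancelˡ-≤ c D _ (≤-trans (+-monoˡ-≤ D c≤J) (≤-reflexive J+D))
          D<m′ : D < d′ * q
          D<m′ = ≤-trans (s≤s (≤-trans D≤ (*-monoˡ-≤ (1 + A * c) (≤-trans (m≤n+m l u′) (≤-reflexive (sym c₁≡))))))
                   (≤-trans (+-monoˡ-≤ (c₁ * (1 + A * c)) c>0) (≤-reflexive (trans (ring c c₁ A) m′≡)))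
            where
            ring : ∀ c c₁ A → c + c₁ * (1 + A * c) ≡ c * (1 + A * c₁) + c₁
            ring = solve-∀
          below : d′ ∣ D → ∃ λ k → N ≡ suc (k * X)
          below (divides T D≡) = finish N refl
            where
            T<q : T < q
            T<q = *-cancelˡ-< d′ T q (subst (_< d′ * q) (trans D≡ (*-comm T d′)) D<m′)
            both : T + (N + b * T) * q ≡ V + (1 + l * A) * q
            both = *-cancelˡ-≡ _ _ d′ (trans (ring₁ d′ q N b T) (trans
              (cong (d′ * q * N +_) (cong₂ _*_ (sym h′≡) (sym D≡))) (trans sum-D (ring₂ d′ q (1 + l * A) V))))
              where
              ring₁ : ∀ d q N b T → d * (T + (N + b * T) * q) ≡ d * q * N + (1 + b * q) * (T * d)
              ring₁ = solve-∀
              ring₂ : ∀ d q k V → d * q * k + d * V ≡ d * (V + k * q)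
              ring₂ = solve-∀
            T≡V : T ≡ V
            T≡V = residue-unique q (N + b * T) (1 + l * A) both T<q V<q
            norm≡ : N + b * T ≡ 1 + l * A
            norm≡ = *-cancelʳ-≡ _ _ q (+-cancelˡ-≡ V _ _ (trans (cong (_+ (N + b * T) * q) (sym T≡V)) both))
            finish : ∀ N′ → N ≡ N′ → ∃ λ k → N ≡ suc (k * X)
            finish zero e = contradiction pos (<-irrefl (sym e))
            finish (suc N₁) e = result N₁ e (∣m+n∣m⇒∣n {m = b * T}
              (subst (X ∣_) (trans (sym (suc-injective (trans (cong (_+ b * T) (sym e)) norm≡))) (+-comm N₁ _)) (∣n⇒∣m*n l X∣A))
              (∣m⇒∣m*n T X∣b))

-- Realising the elements of I(m)

realise : ∀ {n} τ m → 0 < n → n ≡ τ * m → 1 < m → ∀ u w → 0 < u → u ≤ m → 0 < w → w ≤ m →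
          Σ (Subset n) λ G₀ → Σ (Indexed n G₀ m) λ I → let open Indexed I in
          ∃₂ λ y z → y ∈ G₀ × z ∈ G₀ × ι y ≡ u × ι z ≡ w × (∀ g → g ∈ G₀ → ι g ≡ 1 ⊎ ι g ≡ u ⊎ ι g ≡ w)
realise {n} τ m n>0 n≡ 1<m u w u>0 u≤ w>0 w≤ = build (element< 0 1<m) (element u u>0 u≤) (element w w>0 w≤)
  where
  instance
    m≢0 : NonZero m
    m≢0 = >-nonZero (<⇒≤ 1<m)
    τ≢0 : NonZero τ
    τ≢0 = ≢-nonZero λ τ≡0 → >⇒≢ n>0 (trans n≡ (cong (_* m) τ≡0))
  weight : Subset n → Fin n → ℕ
  weight G₀ = Index.ι n G₀ τ m 1

  element< : ∀ v → suc v < m → ∃ λ (g : Fin n) → toℕ g ≡ τ * suc v × (∀ G₀ → weight G₀ g ≡ suc v)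
  element< v v< = fromℕ< lt , toℕ-fromℕ< lt ,
    λ G₀ → Index.ι-unique n G₀ τ m 1 (fromℕ< lt) (suc v) v 1 (toℕ-fromℕ< lt) (<⇒≤ v<) (ring v m)
    where
    lt : τ * suc v < n
    lt = subst (τ * suc v <_) (sym n≡) (*-monoʳ-< τ v<)
    ring : ∀ v m → suc v * 1 + m ≡ suc v + m * 1
    ring = solve-∀

  element : ∀ v → 0 < v → v ≤ m → ∃ λ (g : Fin n) → τ ∣ toℕ g × (∀ G₀ → weight G₀ g ≡ v)
  element (suc v) _ v≤ with m≤n⇒m<n∨m≡n v≤
  ... | inj₁ v< with element< v v<
  ...   | g , g≡ , eq = g , subst (τ ∣_) (sym g≡) (m∣m*n (suc v)) , eq
  -- Weight m belongs to the identity.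
  element (suc v) _ v≤ | inj₂ eq = fromℕ< n>0 , subst (τ ∣_) (sym (toℕ-fromℕ< n>0)) (τ ∣0) ,
    λ G₀ → Index.ι-unique n G₀ τ m 1 (fromℕ< n>0) 0 v 0 (trans (toℕ-fromℕ< n>0) (sym (*-zeroʳ τ))) v≤
      (trans (sym eq) (trans (sym (+-identityʳ (suc v))) (cong (suc v +_) (sym (*-zeroʳ m)))))

  build : (∃ λ (g : Fin n) → toℕ g ≡ τ * 1 × (∀ G₀ → weight G₀ g ≡ 1)) →
          (∃ λ (g : Fin n) → τ ∣ toℕ g × (∀ G₀ → weight G₀ g ≡ u)) →
          (∃ λ (g : Fin n) → τ ∣ toℕ g × (∀ G₀ → weight G₀ g ≡ w)) → _
  build (x , x≡ , ιx) (y , τ∣y , ιy) (z , τ∣z , ιz) = G₀ , I , y , z , y∈ , z∈ , ιy G₀ , ιz G₀ ,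
    elim (λ g → weight G₀ g ≡ 1 ⊎ weight G₀ g ≡ u ⊎ weight G₀ g ≡ w) (inj₁ (ιx G₀)) (inj₂ (inj₁ (ιy G₀))) (inj₂ (inj₂ (ιz G₀)))
    where
    G₀ : Subset n
    G₀ = ⁅ x ⁆ ∪ (⁅ y ⁆ ∪ ⁅ z ⁆)
    x∈ : x ∈ G₀
    x∈ = x∈p∪q⁺ (inj₁ (x∈⁅x⁆ x))
    y∈ : y ∈ G₀
    y∈ = x∈p∪q⁺ {p = ⁅ x ⁆} (inj₂ (x∈p∪q⁺ (inj₁ (x∈⁅x⁆ y))))
    z∈ : z ∈ G₀
    z∈ = x∈p∪q⁺ {p = ⁅ x ⁆} (inj₂ (x∈p∪q⁺ {p = ⁅ y ⁆} (inj₂ (x∈⁅x⁆ z))))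
    elim : (P : Fin n → Set) → P x → P y → P z → ∀ g → g ∈ G₀ → P g
    elim P px py pz g g∈ with x∈p∪q⁻ ⁅ x ⁆ (⁅ y ⁆ ∪ ⁅ z ⁆) g∈
    ... | inj₁ q = subst P (sym (x∈⁅y⁆⇒x≡y x q)) px
    ... | inj₂ r with x∈p∪q⁻ ⁅ y ⁆ ⁅ z ⁆ r
    ...   | inj₁ q = subst P (sym (x∈⁅y⁆⇒x≡y y q)) py
    ...   | inj₂ q = subst P (sym (x∈⁅y⁆⇒x≡y z q)) pz
    I : Indexed n G₀ m
    I = Index.index n G₀ τ m 1 n≡ (elim (λ g → τ ∣ toℕ g) (subst (τ ∣_) (sym x≡) (m∣m*n 1)) τ∣y τ∣z)
          x x∈ 1 1 x≡ (cong suc (sym (*-identityʳ m)))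

module ThreeWeights {n : ℕ} {G₀ : Subset n} {m : ℕ} (I : Indexed n G₀ m) (chain : DivisorChain m)
  (a b c₁′ c₂′ d q : ℕ) (a>0 : 0 < a) (d>0 : 0 < d) (q>0 : 0 < q)
  (m≡ : m ≡ suc c₂′ * (1 + a * suc c₁′) + suc c₁′) (m≡dq : m ≡ d * q) (bq≡ : b * q ≡ a * suc c₁′) where
  open Indexed I
  open Norm I using (ModOne; Atom; ModOne⇒minΔ)
  open PairAtoms I
  c₁ = suc c₁′
  c₂ = suc c₂′
  h = 1 + a * c₁

  S : Shape m
  S = record { t = 1 ; c = c₂ ; c₁ = c₁ ; A = a ; b = b ; d′ = d ; q = q
             ; t>0 = z<s ; c>0 = z<s ; c₁>0 = z<s
             ; m≡ = trans m≡ (sym (*-identityˡ _)) ; m′≡ = trans (sym m≡) m≡dq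
             ; h′≡ = cong suc (sym bq≡) }

  cls : Fin n → Class
  cls g with ι g ≟ h
  ... | yes _ = high
  ... | no _ with ι g ≟ d
  ...   | yes _ = large
  ...   | no _ = small

  fits : ∀ g → ι g ≡ 1 ⊎ ι g ≡ h ⊎ ι g ≡ d → Shape.Fits S (cls g) (ι g) 1
  fits g weights with ι g ≟ h
  ... | yes eq = trans eq (ring h) , (1∣ c₂) , (1∣ d)
    where
    ring : ∀ h → h ≡ 1 * h * 1
    ring = solve-∀
  ... | no ≢h with ι g ≟ d
  ...   | yes eq = subst (_∣ m) (sym eq) (divides q (trans m≡dq (*-comm d q))) , ∣-reflexive (trans (*-identityˡ d) (sym eq))
  ...   | no ≢d = subst (_∣ m) (sym ι≡1) (1∣ m) , subst (_∣ 1 * c₁) (sym ι≡1) (1∣ _)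
    where
    choose : ι g ≡ 1 ⊎ ι g ≡ h ⊎ ι g ≡ d → ι g ≡ 1
    choose (inj₁ eq) = eq
    choose (inj₂ (inj₁ eq)) = contradiction eq ≢h
    choose (inj₂ (inj₂ eq)) = contradiction eq ≢d
    ι≡1 : ι g ≡ 1
    ι≡1 = choose weights

  -- By the `Shape` argument gcd a b divides all distances. It is attained through two atoms:
  -- e^(c₁-1) y^((a+1)c₂+1) of norm a + 1 and z^(q-1) y^d of norm b + 1.
  isMinΔ : ∀ {y z} → y ∈ G₀ → z ∈ G₀ → ι y ≡ h → ι z ≡ d →
           (∀ g → g ∈ G₀ → ι g ≡ 1 ⊎ ι g ≡ h ⊎ ι g ≡ d) → IsMinΔ G₀ (gcd a b)
  isMinΔ {y} {z} y∈ z∈ ιy ιz weights = ModOne⇒minΔ vertex block gcd>0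
      (Shape⇒ModOne I chain S cls (λ _ → 1) (λ g g∈ → fits g (weights g g∈)) (gcd a b) (gcd[m,n]∣m a b) (gcd[m,n]∣n a b))
    where
    gcd>0 : 0 < gcd a b
    gcd>0 = n≢0⇒n>0 λ g≡0 → >⇒≢ a>0 (gcd[m,n]≡0⇒m≡0 g≡0)

    vertex : Atom (pair c₁′ e (1 * (suc a * c₂ + 1)) y) (suc a)
    vertex = vertex-atom 1 c₂ c₁ c₁′ (suc a) e∈ y∈ z<s
      (trans m≡ (cong (λ k → c₂ * k + c₁) (sym H≡)))
      (≤-reflexive (cong suc α≡)) (trans (cong₂ _+_ α≡ H≡) (ring c₁′ a)) (λ _ j _ _ → 1∣ j)
      where
      H≡ : 1 * ι y ≡ h
      H≡ = trans (*-identityˡ _) ιy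
      α≡ : c₁′ * ι e ≡ c₁′
      α≡ = trans (cong (c₁′ *_) ιe) (*-identityʳ c₁′)
      ring : ∀ c a → c + (1 + a * suc c) ≡ suc a * suc c
      ring = solve-∀

    block : Atom (pair (q ∸ 1) z d y) (suc b)
    block = block-atom 1 d q h 0 b z∈ y∈ d>0
      (trans ιz (sym (*-identityˡ d))) (trans ιy (sym (*-identityˡ h)))
      (trans m≡dq (cong (_* q) (sym (*-identityˡ d))))
      (Shape.h′-coprime S) q>0 (trans (cong suc (sym bq≡)) (+-comm 1 (b * q)))

-- x is the minimal distance of {e, h e, d e} for e of order m, where h = (m - c₁) / c₂ = 1 + a c₁.
I⇒Δstar : ∀ {n} → 0 < n → DivisorChain n → ∀ {m x} → m ∣ n → InI m x → InΔstar n x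
I⇒Δstar {n} n>0 chain {m} m∣n@(divides τ n≡)
  (c₁@(suc c₁′) , c₂@(suc c₂′) , d , _ , _ , _ , _ , d∣m@(divides q m≡qd) , lt , a , b , 1≤a , eqa , 1≤b , eqb , refl) =
  conclude (realise τ m n>0 n≡ 1<m h d z<s (<⇒≤ h<m) (>-nonZero⁻¹ d) (∣⇒≤ d∣m))
  where
  1<m : 1 < m
  1<m = ≤-<-trans (s≤s z≤n) lt
  instance
    m≢0 : NonZero m
    m≢0 = >-nonZero (<⇒≤ 1<m)
    d≢0 : NonZero d
    d≢0 = ≢-nonZero λ d≡0 → >⇒≢ (<⇒≤ 1<m) (trans m≡qd (trans (cong (q *_) d≡0) (*-zeroʳ q)))
  h = 1 + a * c₁

  m≡ : m ≡ c₂ * h + c₁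
  m≡ = trans (sym (m+[n∸m]≡n (<⇒≤ lt))) (trans (cong (c₁ + c₂ +_) (trans (sym (∸-+-assoc m c₁ c₂)) (sym eqa))) (ring c₁ c₂ a))
    where
    ring : ∀ c₁ c₂ a → c₁ + c₂ + a * (c₁ * c₂) ≡ c₂ * (1 + a * c₁) + c₁
    ring = solve-∀

  -- With q = m / d, the second integrality condition in M(m) provides the other expression h = 1 +
  -- b q.
  bq≡ : b * q ≡ a * c₁
  bq≡ = *-cancelʳ-≡ _ _ (c₂ * d) {{m*n≢0 c₂ d}} (trans (ring₁ b q c₂ d) (trans (cong (λ k → b * (c₂ * k)) (sym m≡qd))
    (trans eqb (trans (cong (_* d) (sym eqa)) (ring₂ a c₁ c₂ d)))))
    where
    ring₁ : ∀ b q c d → b * q * (c * d) ≡ b * (c * (q * d))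
    ring₁ = solve-∀
    ring₂ : ∀ a c₁ c₂ d → a * (c₁ * c₂) * d ≡ a * c₁ * (c₂ * d)
    ring₂ = solve-∀

  h<m : h < m
  h<m = ≤-trans (≤-trans (≤-reflexive (+-comm 1 h)) (+-mono-≤ (m≤m+n h (c₂′ * h)) (s≤s z≤n))) (≤-reflexive (sym m≡))

  conclude : (Σ (Subset n) λ G₀ → Σ (Indexed n G₀ m) λ I → let open Indexed I in
    ∃₂ λ y z → y ∈ G₀ × z ∈ G₀ × ι y ≡ h × ι z ≡ d × (∀ g → g ∈ G₀ → ι g ≡ 1 ⊎ ι g ≡ h ⊎ ι g ≡ d)) → InΔstar n (gcd a b)
  conclude (G₀ , I , y , z , y∈ , z∈ , ιy , ιz , weights) = G₀ ,
    ThreeWeights.isMinΔ I (DivisorChain-∣ m∣n chain) a b c₁′ c₂′ d q 1≤a (>-nonZero⁻¹ d)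
      (n≢0⇒n>0 λ q≡0 → >⇒≢ (<⇒≤ 1<m) (trans m≡qd (cong (_* d) q≡0)))
      m≡ (trans m≡qd (*-comm q d)) bq≡ y∈ z∈ ιy ιz weights

-- Consequences of a large minimal distance

module Forward {n : ℕ} {G₀ : Subset n} {m : ℕ} (I : Indexed n G₀ m) (chain : DivisorChain m)
  (x : ℕ) (x>0 : 0 < x) (bound : 2 * m * m ≤ x * x * x) (mod : Norm.ModOne I x) where
  open Indexed I
  open Norm I
  open PairAtoms I

  instance
    x≢0 : NonZero x
    x≢0 = >-nonZero x>0

  -- If x² < 2m, squaring gives x⁴ < 4m² ≤ 2x³ and so x < 2, whereas x = 1 violates the bound.
  2m≤x² : 2 * m ≤ x * x
  2m≤x² = ≮⇒≥ λ x²<2m → <⇒≱ (x<2 x²<2m) x≥2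
    where
    x≥2 : 2 ≤ x
    x≥2 = ≮⇒≥ λ x<2 → <⇒≱ (*-mono-≤ (*-monoʳ-≤ 2 0<m) 0<m)
            (≤-trans bound (*-mono-≤ (*-mono-≤ (s≤s⁻¹ x<2) (s≤s⁻¹ x<2)) (s≤s⁻¹ x<2)))
    x<2 : x * x < 2 * m → x < 2
    x<2 lt = *-cancelʳ-< (x * x * x) x 2 (≤-trans (≤-trans (≤-reflexive (cong suc (ring x))) (*-mono-< lt lt))
      (≤-trans (≤-reflexive (ring₂ m)) (*-monoʳ-≤ 2 bound)))
      where
      ring : ∀ x → x * (x * x * x) ≡ x * x * (x * x)
      ring = solve-∀
      ring₂ : ∀ m → 2 * m * (2 * m) ≡ 2 * (2 * m * m)
      ring₂ = solve-∀

  a*x≤m⇒2a≤x : ∀ a → a * x ≤ m → 2 * a ≤ x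
  a*x≤m⇒2a≤x a le = *-cancelʳ-≤ (2 * a) x x (≤-trans (≤-reflexive (*-assoc 2 a x)) (≤-trans (*-monoʳ-≤ 2 le) 2m≤x²))

  2a≤x⇒a<x : ∀ {a} → 2 * a ≤ x → a < x
  2a≤x⇒a<x {zero} _ = x>0
  2a≤x⇒a<x {suc a} le = ≤-trans (m<m+n (suc a) (z<s {a + 0})) le

  a*x≤m⇒a<x : ∀ {a} → a * x ≤ m → a < x
  a*x≤m⇒a<x {a} le = 2a≤x⇒a<x (a*x≤m⇒2a≤x a le)

  -- The data of a weight that does not divide m. Euclid's algorithm on m and ι y arrives at their
  -- gcd t after two divisions, with quotients c and A; h′ is the norm of the full power of y.
  record High (y : Fin n) : Set where
    field
      t h′ m′ c s A : ℕ
      ι≡   : ι y ≡ t * h′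
      m≡t  : m ≡ t * m′
      cop  : Coprime m′ h′
      m≡   : m ≡ c * ι y + s
      s>0  : 0 < s
      t∣s  : t ∣ s
      ι≡A  : ι y ≡ A * s + t
      x∣A  : x ∣ A
      A>0  : 0 < A
      h′≡1 : ∃ λ k₁ → h′ ≡ suc (k₁ * x)
      h′>1 : 1 < h′

    t∣m : t ∣ m
    t∣m = divides m′ (trans m≡t (*-comm t m′))
    t>0 : 0 < t
    t>0 = n≢0⇒n>0 λ t≡0 → >⇒≢ (ι>0 y) (trans ι≡ (cong (_* h′) t≡0))
    c>0 : 0 < c
    c>0 = n≢0⇒n>0 λ c≡0 → <⇒≱ (≤-<-trans (≤-reflexive (trans m≡ (cong (λ k → k * ι y + s) c≡0)))
            (≤-trans (≤-trans (m<m+n s t>0) (+-monoˡ-≤ t (m≤n*m s A {{>-nonZero A>0}}))) (≤-reflexive (sym ι≡A)))) (ι≤m y)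
    x≤A : x ≤ A
    x≤A = ∣⇒≤ {{>-nonZero A>0}} x∣A
    s<ι : s < ι y
    s<ι = ≤-trans (≤-trans (m<m+n s t>0) (+-monoˡ-≤ t (m≤n*m s A {{>-nonZero A>0}}))) (≤-reflexive (sym ι≡A))
    A<ι : A < ι y
    A<ι = ≤-trans (≤-trans (m<m+n A t>0) (+-monoˡ-≤ t (m≤m*n A s {{>-nonZero s>0}}))) (≤-reflexive (sym ι≡A))
    csx≤m : c * s * x ≤ m
    csx≤m = ≤-trans (≤-reflexive (*-assoc c s x)) (≤-trans (*-monoʳ-≤ c
      (≤-trans (≤-trans (*-monoʳ-≤ s x≤A) (≤-reflexive (*-comm s A))) (≤-trans (m≤m+n _ t) (≤-reflexive (sym ι≡A)))))
      (≤-trans (m≤m+n _ s) (≤-reflexive (sym m≡))))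

  -- The same two divisions for H, which will be a multiple μ ι y. The second remainder is taken in
  -- [1, s] rather than [0, s - 1], so that s - ε is a weight to be filled by copies of another
  -- element.
  record Step (H : ℕ) : Set where
    field
      c s A ε : ℕ
      m≡  : m ≡ c * H + s
      s>0 : 0 < s
      H≡  : H ≡ A * s + ε
      ε>0 : 0 < ε
      ε≤s : ε ≤ s
      x∣A : x ∣ A
      A>0 : 0 < A

    x≤A : x ≤ A
    x≤A = ∣⇒≤ {{>-nonZero A>0}} x∣A
    sx<H : s * x < H
    sx<H = ≤-<-trans (≤-trans (*-monoʳ-≤ s x≤A) (≤-reflexive (*-comm s A))) (≤-trans (m<m+n (A * s) ε>0) (≤-reflexive (sym H≡)))

  -- As s - ε + H = (A + 1) s, the vertex atom with (s - ε) / ι z copies of z has norm A + 1. This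
  -- norm is 1 modulo x, so x divides A.
  vertex-step : ∀ {y z} μ → y ∈ G₀ → z ∈ G₀ → 0 < μ → ¬ (μ * ι y ∣ m) → ι z ∣ m → ι z ∣ μ * ι y →
                (∀ i j M → i * ι z + j * ι y ≡ M * m → μ ∣ j) → Step (μ * ι y)
  vertex-step {y} {z} μ y∈ z∈ μ>0 H∤m z∣m z∣H div = record
    { c = c ; s = s ; A = A ; ε = suc r ; m≡ = m≡ ; s>0 = >-nonZero⁻¹ s
    ; H≡ = trans H≡ (+-comm (suc r) _) ; ε>0 = z<s ; ε≤s = r<s
    ; x∣A = divides (proj₁ norm≡) (suc-injective (proj₂ norm≡)) ; A>0 = m≥n⇒m/n>0 (pred-mono-≤ (m%n<n m H)) }
    where
    H = μ * ι y
    instance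
      H≢0 : NonZero H
      H≢0 = >-nonZero (*-mono-< μ>0 (ι>0 y))
    s = m % H
    c = m / H
    instance
      s≢0 : NonZero s
      s≢0 = ≢-nonZero λ s≡0 → H∤m (m%n≡0⇒n∣m m H s≡0)
    A = pred H / s
    r = pred H % s
    r<s : r < s
    r<s = m%n<n (pred H) s
    H≡ : H ≡ suc r + A * s
    H≡ = trans (sym (suc-pred H)) (cong suc (m≡m%n+[m/n]*n (pred H) s))
    m≡ : m ≡ c * H + s
    m≡ = trans (m≡m%n+[m/n]*n m H) (+-comm s _)
    z∣s : ι z ∣ s
    z∣s = ∣m+n∣m⇒∣n (subst (ι z ∣_) m≡ z∣m) (∣n⇒∣m*n c z∣H)
    z∣ε : ι z ∣ suc r
    z∣ε = ∣m+n∣m⇒∣n {m = A * s} (subst (ι z ∣_) (trans H≡ (+-comm (suc r) _)) z∣H) (∣n⇒∣m*n A z∣s)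
    z∣α : ι z ∣ s ∸ suc r
    z∣α = ∣m+n∣m⇒∣n {m = suc r} (subst (ι z ∣_) (sym (m+[n∸m]≡n r<s)) z∣s) z∣ε
    open _∣_ z∣α renaming (quotient to α; equality to α≡)
    norm≡ : ∃ λ k → suc A ≡ suc (k * x)
    norm≡ = mod _ _ (vertex-atom {z} {y} μ c s α (suc A) z∈ y∈ μ>0 m≡
      (≤-trans (≤-reflexive (cong suc (sym α≡))) (∸-monoʳ-< {s} z<s r<s))
      (trans (cong₂ _+_ (sym α≡) H≡) (trans (sym (+-assoc (s ∸ suc r) (suc r) (A * s)))
        (cong (_+ A * s) (m∸n+n≡m r<s))))
      div)

  to-high : ∀ {y} → y ∈ G₀ → ¬ (ι y ∣ m) → High y
  to-high {y} y∈ ∤m with divide-out-gcd (ι y) m 0<m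
  ... | t , h′ , m′ , ι≡ , m≡t , cop′ = record
    { t = t ; h′ = h′ ; m′ = m′ ; c = c ; s = s ; A = A ; ι≡ = ι≡ ; m≡t = m≡t ; cop = Coprimality.sym cop′
    ; m≡ = subst (λ H → m ≡ c * H + s) (*-identityˡ (ι y)) m≡ ; s>0 = s>0 ; t∣s = t∣s
    ; ι≡A = trans ιy≡ (cong (A * s +_) (sym t≡ε))
    ; x∣A = x∣A ; A>0 = A>0 ; h′≡1 = h′≡1 ; h′>1 = h′>1 }
    where
    1∤m : ¬ (1 * ι y ∣ m)
    1∤m d = ∤m (subst (_∣ m) (*-identityˡ (ι y)) d)
    open Step (vertex-step {y} {e} 1 y∈ e∈ z<s 1∤m (subst (_∣ m) (sym ιe) (1∣ m))
                (subst (_∣ 1 * ι y) (sym ιe) (1∣ _)) (λ _ j _ _ → 1∣ j))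
    h′≡1 : ∃ λ k → h′ ≡ suc (k * x)
    h′≡1 = mod _ _ (power-atom t h′ m′ y∈ ι≡ m≡t (Coprimality.sym cop′))
    ιy≡ : ι y ≡ A * s + ε
    ιy≡ = trans (sym (*-identityˡ (ι y))) H≡
    s<x : s < x
    s<x = a*x≤m⇒a<x (≤-trans (<⇒≤ sx<H) (≤-trans (≤-reflexive (*-identityˡ (ι y))) (ι≤m y)))
    t∣s : t ∣ s
    t∣s = ∣m+n∣m⇒∣n {m = c * (1 * ι y)} (subst (t ∣_) m≡ (divides m′ (trans m≡t (*-comm t m′))))
            (∣n⇒∣m*n c (∣n⇒∣m*n 1 (divides h′ (trans ι≡ (*-comm t h′)))))
    ring : ∀ t k x → t * suc (k * x) ≡ t + t * k * x
    ring = solve-∀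
    ring₂ : ∀ k x s → k * x * s ≡ k * s * x
    ring₂ = solve-∀
    -- Since x divides A and h′ - 1, both t and ε are congruent to ι y modulo x, and neither exceeds
    -- s < x.
    t≡ε : t ≡ ε
    t≡ε = residue-unique x (t * proj₁ h′≡1) (k * s)
      (trans (sym (ring t (proj₁ h′≡1) x)) (trans (cong (t *_) (sym (proj₂ h′≡1))) (trans (sym ι≡) (trans ιy≡ (trans (+-comm (A * s) ε)
        (cong (ε +_) (trans (cong (_* s) A≡) (ring₂ k x s))))))))
      (≤-<-trans (∣⇒≤ {{>-nonZero s>0}} t∣s) s<x) (≤-<-trans ε≤s s<x)
      where open _∣_ x∣A renaming (quotient to k; equality to A≡)
    h′>1 : 1 < h′
    h′>1 = ≤∧≢⇒< (≤-trans (s≤s z≤n) (≤-reflexive (sym (proj₂ h′≡1)))) λ 1≡h′ → ∤m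
      (divides m′ (trans m≡t (trans (*-comm t m′) (cong (m′ *_) (trans (sym (*-identityʳ t)) (trans (cong (t *_) 1≡h′) (sym ι≡)))))))

  module _ {y z : Fin n} (y∈ : y ∈ G₀) (z∈ : z ∈ G₀) (Y : High y) (d′ q : ℕ) (ιz : ι z ≡ High.t Y * d′)
           (m≡dq : m ≡ High.t Y * d′ * q) where
    open High Y

    private
      m′≡ : m′ ≡ d′ * q
      m′≡ = *-cancelˡ-≡ m′ (d′ * q) t {{>-nonZero t>0}} (trans (sym m≡t) (trans m≡dq (*-assoc t d′ q)))
      cop-d : Coprime d′ h′
      cop-d (i∣d , i∣h) = cop (subst (_ ∣_) (sym m′≡) (∣m⇒∣m*n q i∣d) , i∣h)
      d>0 : 0 < t * d′
      d>0 = subst (0 <_) ιz (ι>0 z)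
      d′>0 : 0 < d′
      d′>0 = n≢0⇒n>0 λ d≡0 → >⇒≢ d>0 (trans (cong (t *_) d≡0) (*-zeroʳ t))

    -- The hypothesis amounts to q < h′, which makes the quotient b positive. The block atom has
    -- norm b + 1, hence x ∣ b; then q < x, and h′ ≡ 1 modulo x forces the remainder to be 1.
    large-step : m < h′ * ι z → ∃ λ b → h′ ≡ 1 + b * q × x ∣ b × 0 < b
    large-step lt = b , trans h′≡ (trans (+-comm (b * q) _) (cong (_+ b * q) (sym 1≡r))) , x∣b , b>0
      where
      q>0 : 0 < q
      q>0 = n≢0⇒n>0 λ q≡0 → >⇒≢ 0<m (trans m≡dq (trans (cong (t * d′ *_) q≡0) (*-zeroʳ (t * d′))))
      instance
        q≢0 : NonZero q
        q≢0 = >-nonZero q>0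
        h′≢0 : NonZero h′
        h′≢0 = >-nonZero (<⇒≤ h′>1)
      b = pred h′ / q
      r = pred h′ % q
      r<q : r < q
      r<q = m%n<n (pred h′) q
      h′≡ : h′ ≡ b * q + suc r
      h′≡ = trans (sym (suc-pred h′)) (trans (cong suc (m≡m%n+[m/n]*n (pred h′) q)) (+-comm (suc r) _))
      norm≡ : ∃ λ k → suc b ≡ suc (k * x)
      norm≡ = mod _ _ (block-atom t d′ q h′ r b z∈ y∈ d′>0 ιz ι≡ m≡dq cop-d r<q h′≡)
      b≡ : b ≡ proj₁ norm≡ * x
      b≡ = suc-injective (proj₂ norm≡)
      x∣b : x ∣ b
      x∣b = divides (proj₁ norm≡) b≡
      q<h′ : q < h′
      q<h′ = *-cancelˡ-< (t * d′) q h′ (subst₂ _<_ m≡dq (trans (cong (h′ *_) ιz) (*-comm h′ _)) lt)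
      b>0 : 0 < b
      b>0 = m≥n⇒m/n>0 (pred-mono-≤ q<h′)
      q<x : q < x
      q<x = a*x≤m⇒a<x (≤-trans (*-monoʳ-≤ q (∣⇒≤ {{>-nonZero b>0}} x∣b)) (≤-trans (≤-reflexive (*-comm q b))
        (≤-trans (m≤m+n _ (suc r)) (≤-trans (≤-reflexive (sym h′≡))
          (≤-trans (≤-trans (m≤n*m h′ t {{>-nonZero t>0}}) (≤-reflexive (sym ι≡))) (ι≤m y))))))
      ring : ∀ k x q → k * x * q ≡ k * q * x
      ring = solve-∀
      1≡r : 1 ≡ suc r
      1≡r = residue-unique x (proj₁ h′≡1) (proj₁ norm≡ * q)
        (trans (sym (proj₂ h′≡1)) (trans h′≡ (trans (+-comm (b * q) (suc r))
          (cong (suc r +_) (trans (cong (_* q) b≡) (ring (proj₁ norm≡) x q))))))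
        (≤-<-trans q>0 q<x) (≤-<-trans r<q q<x)

    -- `vertex-step` is applied to blocks of d′ copies of y, of weight H = h′ ι z ≤ m. The remainder
    -- of m modulo H is then below x, hence below ι y, and since ι y ∣ H it equals s; but ι z
    -- divides both m and H.
    small-step : h′ * ι z ≤ m → ι z ∣ s
    small-step le = subst (ι z ∣_) s̃≡s z∣s̃
      where
      H = d′ * ι y
      ring : ∀ d t h → d * (t * h) ≡ h * (t * d)
      ring = solve-∀
      H≡hz : H ≡ h′ * ι z
      H≡hz = trans (cong (d′ *_) ι≡) (trans (ring d′ t h′) (cong (h′ *_) (sym ιz)))
      H∤m : ¬ (H ∣ m)
      H∤m H∣m = >⇒≢ h′>1 (cop (subst (h′ ∣_) (sym m′≡) (∣n⇒∣m*n d′ h′∣q) , ∣-refl))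
        where
        h′∣q : h′ ∣ q
        h′∣q = *-cancelʳ-∣ (t * d′) {{>-nonZero d>0}} (subst₂ _∣_ (trans H≡hz (cong (h′ *_) ιz))
                     (trans m≡dq (*-comm _ q)) H∣m)
      z∣m : ι z ∣ m
      z∣m = divides q (trans m≡dq (trans (*-comm _ q) (cong (q *_) (sym ιz))))
      open Step (vertex-step d′ y∈ z∈ d′>0 H∤m z∣m (divides h′ H≡hz) (blocks t d′ q h′ ιz ι≡ m≡dq cop-d))
        renaming (c to c̃; s to s̃; m≡ to m≡c̃; sx<H to s̃x<H) using ()
      z∣s̃ : ι z ∣ s̃
      z∣s̃ = ∣m+n∣m⇒∣n {m = c̃ * H} (subst (ι z ∣_) m≡c̃ z∣m) (∣n⇒∣m*n c̃ (divides h′ H≡hz))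
      s̃<ι : s̃ < ι y
      s̃<ι = <-trans (a*x≤m⇒a<x (≤-trans (<⇒≤ s̃x<H) (≤-trans (≤-reflexive H≡hz) le))) (≤-<-trans x≤A A<ι)
      ring₂ : ∀ s c d w → s + c * d * w ≡ c * (d * w) + s
      ring₂ = solve-∀
      s̃≡s : s̃ ≡ s
      s̃≡s = residue-unique (ι y) (c̃ * d′) c
        (trans (ring₂ s̃ c̃ d′ (ι y)) (trans (sym m≡c̃) (trans m≡ (+-comm _ s)))) s̃<ι s<ι

  -- If no divisor of v has norm 1, each of the γ atoms in a factorization has norm 1 + kᵢ x with kᵢ ≥ 1.
  few-factors : ∀ fuel M v → M ≤ fuel → Over G₀ v → ⟨ v , ι ⟩ ≡ M * m → (∀ w → w ≤ₛ v → ⟨ w , ι ⟩ ≢ m) →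
                ¬ ¬ (∃₂ λ γ k → M ≡ γ + k * x × γ ≤ k × (0 < M → 0 < γ))
  few-factors fuel zero v le ov eq none K = K (0 , 0 , refl , z≤n , λ p → p)
  few-factors (suc fuel) M@(suc _) v le ov eq none K = conclude (mod v M atom)
    where
    atom : Atom v M
    atom = record { over = ov ; norm = eq ; pos = z<s ; irr = irr′ }
      where
      irr′ : ∀ w M′ → w ≤ₛ v → ⟨ w , ι ⟩ ≡ M′ * m → M′ ≡ 0 ⊎ M′ ≡ M
      irr′ w zero w≤ eqw = inj₁ refl
      irr′ w M′@(suc _) w≤ eqw with M′ ≟ M
      ... | yes M′≡M = inj₂ M′≡M
      -- A proper zero-sum divisor splits v, and both halves recurse. Under the double negation this
      -- refutes such a divisor, so v can be treated as an atom without deciding whether it is one.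
      ... | no M′≢M = ⊥-elim
        (few-factors fuel M′ w (s≤s⁻¹ (≤-trans M′<M le)) (Over-≤ {w = w} w≤ ov) eqw
          (λ u u≤ → none u λ g → ≤-trans (u≤ g) (w≤ g)) λ (γ , k , p , q , r) →
        few-factors fuel (M ∸ M′) (v ⊖ w) (s≤s⁻¹ (≤-trans (∸-monoʳ-< z<s (<⇒≤ M′<M)) le))
          (Over-≤ {w = v ⊖ w} (⊖-≤ v w) ov) rest
          (λ u u≤ → none u λ g → ≤-trans (u≤ g) (⊖-≤ v w g)) λ (γ′ , k′ , p′ , q′ , r′) →
        K (γ + γ′ , k + k′ , trans (sym (m+[n∸m]≡n (<⇒≤ M′<M))) (trans (cong₂ _+_ p p′) (ring γ k γ′ k′ x)) ,
           +-mono-≤ q q′ , λ _ → ≤-trans (r z<s) (m≤m+n γ γ′)))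
        where
        M′<M : M′ < M
        M′<M = ≤∧≢⇒< (*-cancelʳ-≤ M′ M m (≤-trans (≤-reflexive (sym eqw))
                 (≤-trans (⟨⟩-monoˡ ι w≤) (≤-reflexive eq)))) M′≢M
        rest : ⟨ v ⊖ w , ι ⟩ ≡ (M ∸ M′) * m
        rest = +-cancelˡ-≡ (M′ * m) _ _ (trans (cong (_+ ⟨ v ⊖ w , ι ⟩) (sym eqw)) (trans (sym (⟨⟩-⊖ ι w≤)) (trans eq
          (trans (cong (_* m) (sym (m+[n∸m]≡n (<⇒≤ M′<M)))) (*-distribʳ-+ m M′ (M ∸ M′))))))
        ring : ∀ γ k γ′ k′ x → γ + k * x + (γ′ + k′ * x) ≡ γ + γ′ + (k + k′) * x
        ring = solve-∀
    conclude : (∃ λ k → M ≡ suc (k * x)) → ⊥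
    conclude (zero , M≡1) = none v (λ _ → ≤-refl) (trans eq (trans (cong (_* m) M≡1) (*-identityˡ m)))
    conclude (suc k , M≡) = K (1 , suc k , M≡ , s≤s z≤n , λ _ → z<s)

  module _ {y₁ y₂ : Fin n} (y₁∈ : y₁ ∈ G₀) (y₂∈ : y₂ ∈ G₀) (Y₁ : High y₁) (Y₂ : High y₂)
           (s₂≤s₁ : High.s Y₂ ≤ High.s Y₁) where
    private
      module H₁ = High Y₁
      module H₂ = High Y₂
      w₁ w₂ s₁ s₂ a e′ D : ℕ
      w₁ = ι y₁
      w₂ = ι y₂
      s₁ = H₁.s
      s₂ = H₂.s
      a = H₁.c
      e′ = H₂.c

      2s₁≤x : 2 * s₁ ≤ x
      2s₁≤x = a*x≤m⇒2a≤x s₁ (≤-trans (*-monoˡ-≤ x (m≤n*m s₁ a {{>-nonZero H₁.c>0}})) H₁.csx≤m)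
      s₁<x : s₁ < x
      s₁<x = 2a≤x⇒a<x 2s₁≤x
      D = H₂.A ∸ s₁
      A₂≡ : H₂.A ≡ s₁ + D
      A₂≡ = sym (m+[n∸m]≡n (<⇒≤ (<-≤-trans s₁<x H₂.x≤A)))
      t₂≤s₂ : H₂.t ≤ s₂
      t₂≤s₂ = ∣⇒≤ {{>-nonZero H₂.s>0}} H₂.t∣s

      -- The vertex sequence e^(s₂-t₂) y₂^((1+A₂)e′+1) has norm 1 + A₂. Exchanging s₁ blocks y₂^e′,
      -- each of weight m - s₂, for s₂ blocks y₁^a, each of weight m - s₁, changes the norm by s₂ -
      -- s₁ and produces B.
      B : Seq n
      B = (s₂ ∸ H₂.t) ⊙ δ e ⊕ pair (s₂ * a) y₁ (e′ * (1 + D) + 1) y₂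

      B-over : Over G₀ B
      B-over = Over-⊕ {v = (s₂ ∸ H₂.t) ⊙ δ e} {pair (s₂ * a) y₁ (e′ * (1 + D) + 1) y₂}
        (Over-⊙ {v = δ e} (s₂ ∸ H₂.t) (Over-δ e∈)) (Over-pair (s₂ * a) (e′ * (1 + D) + 1) y₁∈ y₂∈)

      B-norm : ⟨ B , ι ⟩ ≡ (1 + D + s₂) * m
      B-norm = trans (⟨⟩-⊕ ((s₂ ∸ H₂.t) ⊙ δ e) (pair (s₂ * a) y₁ (e′ * (1 + D) + 1) y₂) ι)
        (trans (cong₂ _+_ (trans (⟨⊙δ⟩ (s₂ ∸ H₂.t) e ι) (trans (cong ((s₂ ∸ H₂.t) *_) ιe) (*-identityʳ (s₂ ∸ H₂.t))))
                          (⟨pair⟩ (s₂ * a) y₁ (e′ * (1 + D) + 1) y₂ ι))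
        (trans (ring₁ (s₂ ∸ H₂.t) s₂ a w₁ e′ D w₂)
        (trans (cong (λ k → s₂ ∸ H₂.t + (s₂ * (a * w₁) + (1 + D) * (e′ * w₂) + k)) (trans H₂.ι≡A (cong (λ k → k * s₂ + H₂.t) A₂≡)))
        (trans (ring₂ (s₂ ∸ H₂.t) s₂ (a * w₁) D (e′ * w₂) s₁ H₂.t)
        (trans (cong (λ k → k + D * s₂ + s₂ * (a * w₁ + s₁) + (1 + D) * (e′ * w₂)) (m∸n+n≡m t₂≤s₂))
        (trans (ring₃ s₂ D (a * w₁ + s₁) (e′ * w₂))
        (trans (cong₂ (λ p q → s₂ * p + (1 + D) * q) (sym H₁.m≡) (sym H₂.m≡)) (ring₄ s₂ D m))))))))
        where
        ring₁ : ∀ u s a w e D w′ → u + (s * a * w + (e * (1 + D) + 1) * w′) ≡ u + (s * (a * w) + (1 + D) * (e * w′) + w′)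
        ring₁ = solve-∀
        ring₂ : ∀ u s p D q s₁ t → u + (s * p + (1 + D) * q + ((s₁ + D) * s + t)) ≡ (u + t) + D * s + s * (p + s₁) + (1 + D) * q
        ring₂ = solve-∀
        ring₃ : ∀ s D p q → s + D * s + s * p + (1 + D) * q ≡ s * p + (1 + D) * (q + s)
        ring₃ = solve-∀
        ring₄ : ∀ s D m → s * m + (1 + D) * m ≡ (1 + D + s) * m
        ring₄ = solve-∀

      Q = a * e′
      -- The factors a s₁ x and e′ x are each at most m, and 2m² ≤ x³ is used in full strength.
      2Qs₁≤x : 2 * (Q * s₁) ≤ x
      2Qs₁≤x = *-cancelʳ-≤ _ x (x * x) {{m*n≢0 x x}} (≤-trans (≤-reflexive (ring₁ a e′ s₁ x))
        (≤-trans (*-monoʳ-≤ 2 (*-mono-≤ H₁.csx≤m ex≤m)) (≤-trans (≤-reflexive (ring₂ m)) (≤-trans bound (≤-reflexive (*-assoc x x x))))))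
        where
        ex≤m : e′ * x ≤ m
        ex≤m = ≤-trans (*-monoˡ-≤ x (m≤m*n e′ s₂ {{>-nonZero H₂.s>0}})) H₂.csx≤m
        ring₁ : ∀ a e s x → 2 * (a * e * s) * (x * x) ≡ 2 * (a * s * x * (e * x))
        ring₁ = solve-∀
        ring₂ : ∀ m → 2 * (m * m) ≡ 2 * m * m
        ring₂ = solve-∀

      Qs₁+s₁<m : Q * s₁ + s₁ < m
      Qs₁+s₁<m = ≤-<-trans (*-cancelˡ-≤ 2 (≤-trans (≤-reflexive (*-distribˡ-+ 2 (Q * s₁) s₁))
        (≤-trans (+-mono-≤ 2Qs₁≤x 2s₁≤x) (≤-reflexive (cong (x +_) (sym (+-identityʳ x)))))))
        (≤-<-trans H₁.x≤A (<-≤-trans H₁.A<ι (ι≤m y₁)))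

      -- Multiplying by Q and substituting a w₁ = m - s₁ and e′ w₂ = m - s₂ yields `balance`. For P
      -- ≤ Q its left side is too large, because u < s₂ ≤ s₁. For P = Q + F with F > 0 it would need
      -- F m ≤ (Q + F) s₁, which `Qs₁+s₁<m` forbids.
      no-norm-one : ∀ u i j → u ≤ s₂ ∸ H₂.t → u + (i * w₁ + j * w₂) ≢ m
      no-norm-one u i j u≤ eq = [ few , (λ Q≤P → many Q≤P (P ∸ Q) refl) ]′ (≤-total P Q)
        where
        P = i * e′ + j * a
        u<s₂ : u < s₂
        u<s₂ = ≤-<-trans u≤ (∸-monoʳ-< H₂.t>0 t₂≤s₂)
        balance : Q * m + (i * e′ * s₁ + j * a * s₂) ≡ Q * u + P * m
        balance = trans (cong (λ k → Q * k + (i * e′ * s₁ + j * a * s₂)) (sym eq))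
          (trans (ring₁ a e′ u i j w₁ w₂ s₁ s₂)
            (trans (cong₂ (λ p q → Q * u + (i * e′ * p + j * a * q)) (sym H₁.m≡) (sym H₂.m≡)) (ring₂ (Q * u) i e′ j a m)))
          where
          ring₁ : ∀ a e u i j w₁ w₂ s₁ s₂ → a * e * (u + (i * w₁ + j * w₂)) + (i * e * s₁ + j * a * s₂) ≡
                    a * e * u + (i * e * (a * w₁ + s₁) + j * a * (e * w₂ + s₂))
          ring₁ = solve-∀
          ring₂ : ∀ q i e j a m → q + (i * e * m + j * a * m) ≡ q + (i * e + j * a) * m
          ring₂ = solve-∀
        few : P ≤ Q → ⊥
        few P≤Q = <⇒≱ (*-monoʳ-< Q {{m*n≢0 a e′ {{>-nonZero H₁.c>0}} {{>-nonZero H₂.c>0}}}} (n<1+n u))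
          (+-cancelʳ-≤ (P * m) _ _ (≤-trans bigger (≤-reflexive balance)))
          where
          E = Q ∸ P
          Q≡ : Q ≡ P + E
          Q≡ = sym (m+[n∸m]≡n P≤Q)
          ring : ∀ P E u m → (P + E) * suc u + P * m ≡ P * suc u + (P * m + E * suc u)
          ring = solve-∀
          ring′ : ∀ P E m s → P * s + (P * m + E * m) ≡ (P + E) * m + P * s
          ring′ = solve-∀
          bigger : Q * suc u + P * m ≤ Q * m + (i * e′ * s₁ + j * a * s₂)
          bigger = ≤-trans (≤-reflexive (trans (cong (λ k → k * suc u + P * m) Q≡) (ring P E u m)))
            (≤-trans (+-mono-≤ (*-monoʳ-≤ P u<s₂) (+-monoʳ-≤ (P * m) (*-monoʳ-≤ E (≤-trans u<s₂ (<⇒≤ (<-≤-trans H₂.s<ι (ι≤m y₂)))))))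
            (≤-trans (≤-reflexive (ring′ P E m s₂)) (≤-trans (+-monoˡ-≤ (P * s₂) (≤-reflexive (cong (_* m) (sym Q≡))))
              (+-monoʳ-≤ (Q * m) (≤-trans (≤-reflexive (*-distribʳ-+ s₂ (i * e′) (j * a)))
                (+-monoˡ-≤ (j * a * s₂) (*-monoʳ-≤ (i * e′) s₂≤s₁)))))))
        many : Q ≤ P → ∀ F → P ∸ Q ≡ F → ⊥
        many Q≤P zero F≡ = few (m∸n≡0⇒m≤n F≡)
        many Q≤P F@(suc F′) F≡ = <⇒≱ (*-monoʳ-< F Qs₁+s₁<m) (≤-trans Fm≤ (≤-trans (≤-reflexive (*-distribʳ-+ s₁ Q F))
            (≤-trans (+-monoˡ-≤ (F * s₁) (m≤n*m (Q * s₁) F)) (≤-reflexive (sym (*-distribˡ-+ F (Q * s₁) s₁))))))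
          where
          P≡ : P ≡ Q + F
          P≡ = trans (sym (m+[n∸m]≡n Q≤P)) (cong (Q +_) F≡)
          ring : ∀ Q u F m → Q * u + (Q + F) * m ≡ Q * m + (F * m + Q * u)
          ring = solve-∀
          Fm≤ : F * m ≤ (Q + F) * s₁
          Fm≤ = ≤-trans (m≤m+n (F * m) (Q * u)) (≤-trans (≤-reflexive (+-cancelˡ-≡ (Q * m) _ _
            (trans (sym (ring Q u F m)) (trans (cong (λ k → Q * u + k * m) (sym P≡)) (sym balance)))))
            (≤-trans (+-monoʳ-≤ (i * e′ * s₁) (*-monoʳ-≤ (j * a) s₂≤s₁))
              (≤-reflexive (trans (sym (*-distribʳ-+ s₁ (i * e′) (j * a))) (cong (_* s₁) P≡)))))

      B-none : ∀ w → w ≤ₛ B → ⟨ w , ι ⟩ ≢ m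
      B-none w le eq with split-≤ le
      ... | v₁ , v₂ , le₁ , le₂ , v≐ with ≤⊙δ-sum {k = s₂ ∸ H₂.t} e le₁ | ≤pair {a = s₂ * a} {e′ * (1 + D) + 1} le₂
      ... | u , u≤ , sum₁ | i , j , _ , _ , sum₂ = no-norm-one u i j u≤
        (trans (cong₂ _+_ (trans (sym (*-identityʳ u)) (trans (cong (u *_) (sym ιe)) (sym (sum₁ ι)))) (sym (sum₂ ι)))
          (trans (sym (⟨⟩-⊕ v₁ v₂ ι)) (trans (⟨⟩-congˡ ι v≐) eq)))

    -- B factors into γ ≥ 1 atoms, none of norm one, and 1 + A₂ + s₂ - s₁ = γ + k x. As x ∣ A₂, the
    -- number γ - 1 + (s₁ - s₂) is 0 modulo x; it is below x, since γ ≤ A₂ / x and both A₂ / x and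
    -- s₁ are at most x / 2.
    same-remainder : s₁ ≡ s₂
    same-remainder = decidable-stable (s₁ ≟ s₂) λ s≢ →
      few-factors (1 + D + s₂) (1 + D + s₂) B ≤-refl B-over B-norm B-none λ (γ , k , N≡ , γ≤k , γ>0) →
        s≢ (equate γ k N≡ γ≤k (γ>0 z<s))
      where
      equate : ∀ γ k → 1 + D + s₂ ≡ γ + k * x → γ ≤ k → 0 < γ → s₁ ≡ s₂
      equate (suc γ′) k N≡ γ≤k _ = ≤-antisym (m∸n≡0⇒m≤n (m+n≡0⇒n≡0 γ′ zero-gap)) s₂≤s₁
        where
        open _∣_ H₂.x∣A renaming (quotient to k₂; equality to A₂≡k)
        F = s₁ ∸ s₂
        s₁≡ : s₁ ≡ s₂ + F
        s₁≡ = sym (m+[n∸m]≡n s₂≤s₁)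
        ring₁ : ∀ γ F k s → suc (γ + F + k + s) ≡ suc γ + k + (s + F)
        ring₁ = solve-∀
        ring₂ : ∀ D s s₁ → 1 + D + s + s₁ ≡ suc (s₁ + D + s)
        ring₂ = solve-∀
        gap : γ′ + F + k * x ≡ k₂ * x
        gap = +-cancelʳ-≡ s₂ _ _ (suc-injective (trans (ring₁ γ′ F (k * x) s₂)
          (trans (cong₂ _+_ (sym N≡) (sym s₁≡)) (trans (ring₂ D s₂ s₁) (cong (λ k → suc (k + s₂)) (trans (sym A₂≡) A₂≡k))))))
        k≤k₂ : k ≤ k₂
        k≤k₂ = *-cancelʳ-≤ k k₂ x (≤-trans (m≤n+m (k * x) (γ′ + F)) (≤-reflexive gap))
        2k₂≤x : 2 * k₂ ≤ x
        2k₂≤x = a*x≤m⇒2a≤x k₂ (≤-trans (≤-reflexive (sym A₂≡k)) (<⇒≤ (<-≤-trans H₂.A<ι (ι≤m y₂))))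
        γ+F<x : γ′ + F < x
        γ+F<x = <-≤-trans (+-mono-<-≤ (≤-trans γ≤k k≤k₂) (m∸n≤m s₁ s₂)) (*-cancelˡ-≤ 2
          (≤-trans (≤-reflexive (*-distribˡ-+ 2 k₂ s₁)) (≤-trans (+-mono-≤ 2k₂≤x 2s₁≤x) (≤-reflexive (cong (x +_) (sym (+-identityʳ x)))))))
        zero-gap : γ′ + F ≡ 0
        zero-gap = residue-unique x k k₂ gap γ+F<x x>0

-- Computing the minimal distance

module Assemble {n : ℕ} {G₀ : Subset n} {m : ℕ} (I : Indexed n G₀ m) (chain : DivisorChain m)
  (x : ℕ) (x>0 : 0 < x) (bound : 2 * m * m ≤ x * x * x) (mod : Norm.ModOne I x)
  (y₀ : Fin n) (y₀∈ : y₀ ∈ G₀) (Y₀ : Forward.High I chain x x>0 bound mod y₀)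
  (least : ∀ g → g ∈ G₀ → ¬ (Indexed.ι I g ∣ m) → Indexed.ι I y₀ ≤ Indexed.ι I g) where
  open Indexed I
  open Norm I
  open Forward I chain x x>0 bound mod

  open High Y₀

  same-s : ∀ {y} → y ∈ G₀ → (Y : High y) → s ≡ High.s Y
  same-s y∈ Y with ≤-total s (High.s Y)
  ... | inj₁ le = sym (same-remainder y∈ y₀∈ Y Y₀ le)
  ... | inj₂ le = same-remainder y₀∈ y∈ Y₀ Y le

  same-cι : ∀ {y} → y ∈ G₀ → (Y : High y) → c * ι y₀ ≡ High.c Y * ι y
  same-cι {y} y∈ Y = +-cancelʳ-≡ s _ _ (trans (sym m≡) (trans (High.m≡ Y) (cong (High.c Y * ι y +_) (sym (same-s y∈ Y)))))

  -- Both sides are congruent modulo x to the common value m - s of the products c ι, and both are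
  -- below x because c t ≤ c s ≤ m / x.
  same-ct : ∀ {y} → y ∈ G₀ → (Y : High y) → c * t ≡ High.c Y * High.t Y
  same-ct {y} y∈ Y = residue-unique x (c * k * s) (H.c * k′ * H.s)
      (trans (sym (ring c k x s t)) (trans (cong (λ A → c * (A * s + t)) (sym A≡)) (trans (cong (c *_) (sym ι≡A))
        (trans (same-cι y∈ Y) (trans (cong (H.c *_) H.ι≡A) (trans (cong (λ A → H.c * (A * H.s + H.t)) A′≡) (ring H.c k′ x H.s H.t)))))))
      (ct<x Y₀) (ct<x Y)
    where
    module H = High Y
    open _∣_ x∣A renaming (quotient to k; equality to A≡)
    open _∣_ H.x∣A renaming (quotient to k′; equality to A′≡)
    ring : ∀ c k x s t → c * (k * x * s + t) ≡ c * t + c * k * s * x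
    ring = solve-∀
    ct<x : ∀ {y} (Y : High y) → High.c Y * High.t Y < x
    ct<x Y = ≤-<-trans (*-monoʳ-≤ (High.c Y) (∣⇒≤ {{>-nonZero (High.s>0 Y)}} (High.t∣s Y))) (a*x≤m⇒a<x (High.csx≤m Y))

  -- Let c′, t′ belong to y. Minimality of ι y₀ gives c′ ≤ c, so t ≤ t′, and the divisor chain
  -- yields t′ = t j. Now c t = c′ t′ gives c = c′ j, and c ι y₀ = c′ ι y gives ι y = ι y₀ j.
  ratio : ∀ {y} → y ∈ G₀ → ¬ (ι y ∣ m) → High y → ∃ λ j → ι y ≡ t * h′ * j × j ∣ c × t * j ∣ m
  ratio {y} y∈ ∤m Y = j , ι≡j , divides H.c c≡ , subst (_∣ m) (trans tj≡ (*-comm j t)) H.t∣m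
    where
    module H = High Y
    instance
      c′≢0 : NonZero H.c
      c′≢0 = >-nonZero H.c>0
      t≢0 : NonZero t
      t≢0 = >-nonZero t>0
      ι≢0 : NonZero (ι y₀)
      ι≢0 = >-nonZero (ι>0 y₀)
    c′≤c : H.c ≤ c
    c′≤c = *-cancelʳ-≤ H.c c (ι y₀) (≤-trans (*-monoʳ-≤ H.c (least y y∈ ∤m)) (≤-reflexive (sym (same-cι y∈ Y))))
    t≤t′ : t ≤ H.t
    t≤t′ = *-cancelˡ-≤ H.c (≤-trans (*-monoˡ-≤ t c′≤c) (≤-reflexive (same-ct y∈ Y)))
    open _∣_ (chain-≤⇒∣ chain t>0 t∣m H.t∣m t≤t′) renaming (quotient to j; equality to tj≡)
    ring : ∀ c j t → c * (j * t) ≡ j * c * t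
    ring = solve-∀
    ring₂ : ∀ c j w → j * c * w ≡ c * (w * j)
    ring₂ = solve-∀
    c≡ : c ≡ H.c * j
    c≡ = *-cancelʳ-≡ c _ t (trans (same-ct y∈ Y) (trans (cong (H.c *_) tj≡) (trans (ring H.c j t) (cong (_* t) (*-comm j H.c)))))
    ι≡j : ι y ≡ t * h′ * j
    ι≡j = *-cancelˡ-≡ (ι y) _ H.c (trans (sym (same-cι y∈ Y)) (trans (cong (_* ι y₀) (trans c≡ (*-comm H.c j)))
      (trans (ring₂ H.c j (ι y₀)) (cong (λ w → H.c * (w * j)) ι≡))))

  ∣large : ∀ {d u} → d ∣ m → m < h′ * d → 0 < u → u ∣ m → h′ * u ≤ m → u ∣ d
  ∣large {d} {u} d∣m lt u>0 u∣m le with chain u d u∣m d∣m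
  ... | inj₁ u∣d = u∣d
  ... | inj₂ d∣u = contradiction (≤-trans (*-monoʳ-≤ h′ (∣⇒≤ {{>-nonZero u>0}} d∣u)) le) (<⇒≱ lt)

  ht≤m : h′ * t ≤ m
  ht≤m = ≤-trans (≤-reflexive (trans (*-comm h′ t) (sym ι≡))) (ι≤m y₀)

  -- The threshold m / h′ separates the divisor weights subject to `large-step` from those subject
  -- to `small-step`; t d′ is to be the smallest one above it.
  record Large : Set where
    field
      d′ q b : ℕ
      m≡dq  : m ≡ t * d′ * q
      m<hd  : m < h′ * (t * d′)
      h′≡   : h′ ≡ 1 + b * q
      x∣b   : x ∣ b
      b>0   : 0 < b
      divs  : ∀ g → g ∈ G₀ → ι g ∣ m → m < h′ * ι g → t * d′ ∣ ι g

  smallest-large : Large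
  smallest-large with argmin (λ g → (g ∈? G₀) ×-dec ((ι g ∣? m) ×-dec (m <? h′ * ι g))) ι
  -- With no weight above the threshold, m itself takes the place of t d′, with q = 1 and b = h′ -
  -- 1.
  ... | inj₂ none = record
    { d′ = m′ ; q = 1 ; b = proj₁ h′≡1 * x ; m≡dq = trans m≡t (sym (*-identityʳ _))
    ; m<hd = subst (λ k → m < h′ * k) m≡t (subst (_< h′ * m) (*-identityˡ m) (*-monoˡ-< m h′>1))
    ; h′≡ = trans (proj₂ h′≡1) (cong suc (sym (*-identityʳ _)))
    ; x∣b = n∣m*n (proj₁ h′≡1) ; b>0 = s≤s⁻¹ (≤-trans h′>1 (≤-reflexive (proj₂ h′≡1)))
    ; divs = λ g g∈ ∣m lt → contradiction (g∈ , ∣m , lt) (none g) }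
  ... | inj₁ (z , (z∈ , z∣m , lt) , z-least) = from (large-step y₀∈ z∈ Y₀ d′ q ιz m≡dq lt)
    where
    open _∣_ (∣large z∣m lt t>0 t∣m ht≤m) renaming (quotient to d′; equality to z≡)
    open _∣_ z∣m renaming (quotient to q; equality to m≡qz)
    ιz : ι z ≡ t * d′
    ιz = trans z≡ (*-comm d′ t)
    m≡dq : m ≡ t * d′ * q
    m≡dq = trans m≡qz (trans (*-comm q (ι z)) (cong (_* q) ιz))
    from : (∃ λ b → h′ ≡ 1 + b * q × x ∣ b × 0 < b) → Large
    from (b , h′≡ , x∣b , b>0) = record
      { d′ = d′ ; q = q ; b = b ; m≡dq = m≡dq ; m<hd = subst (λ k → m < h′ * k) ιz lt ; h′≡ = h′≡ ; x∣b = x∣b ; b>0 = b>0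
      ; divs = λ g g∈ g∣m g-lt → subst (_∣ ι g) ιz (chain-≤⇒∣ chain (ι>0 z) z∣m g∣m (z-least g (g∈ , g∣m , g-lt))) }

  module _ (L : Large) where
    open Large L
    open _∣_ t∣s renaming (quotient to c₁; equality to s≡)

    private instance
      t≢0 : NonZero t
      t≢0 = >-nonZero t>0

    c₁>0 : 0 < c₁
    c₁>0 = n≢0⇒n>0 λ c₁≡0 → >⇒≢ s>0 (trans s≡ (cong (_* t) c₁≡0))

    h′≡A : h′ ≡ 1 + A * c₁
    h′≡A = *-cancelˡ-≡ h′ _ t (trans (sym ι≡) (trans ι≡A (trans (cong (λ k → A * k + t) s≡) (ring A c₁ t))))
      where
      ring : ∀ A c t → A * (c * t) + t ≡ t * (1 + A * c)
      ring = solve-∀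

    m′≡ : m′ ≡ c * (1 + A * c₁) + c₁
    m′≡ = *-cancelˡ-≡ m′ _ t (trans (sym m≡t) (trans m≡ (trans (cong₂ (λ w r → c * w + r) (trans ι≡ (cong (t *_) h′≡A)) s≡)
      (ring c t (1 + A * c₁) c₁))))
      where
      ring : ∀ c t h c₁ → c * (t * h) + c₁ * t ≡ t * (c * h + c₁)
      ring = solve-∀

    m′≡dq : m′ ≡ d′ * q
    m′≡dq = *-cancelˡ-≡ m′ _ t (trans (sym m≡t) (trans m≡dq (*-assoc t d′ q)))

    shape : Shape m
    shape = record { t = t ; c = c ; c₁ = c₁ ; A = A ; b = b ; d′ = d′ ; q = q ; t>0 = t>0 ; c>0 = c>0 ; c₁>0 = c₁>0
                   ; m≡ = trans m≡t (cong (t *_) m′≡) ; m′≡ = trans (sym m′≡) m′≡dq ; h′≡ = trans (sym h′≡A) h′≡ }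

    private instance
      ι₀≢0 : NonZero (ι y₀)
      ι₀≢0 = >-nonZero (ι>0 y₀)

    -- Taking the decisions as arguments lets `fits` split on them by pattern matching.
    class-of : ∀ {P Q : Set} → Dec P → Dec Q → Class
    class-of (no _)  _       = high
    class-of (yes _) (yes _) = large
    class-of (yes _) (no _)  = small

    cls : Fin n → Class
    cls g = class-of (ι g ∣? m) (m <? h′ * ι g)

    small-∣ : ∀ {g} → g ∈ G₀ → ι g ∣ m → h′ * ι g ≤ m → t ∣ ι g ⊎ ι g ∣ t → ι g ∣ s
    small-∣ g∈ _ le (inj₂ g∣t) = ∣-trans g∣t t∣s
    small-∣ {g} g∈ (divides r m≡rg) le (inj₁ (divides d eq)) = small-step y₀∈ g∈ Y₀ d r (trans eq (*-comm d t))
        (trans m≡rg (trans (*-comm r (ι g)) (cong (_* r) (trans eq (*-comm d t))))) le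

    -- As h′ t j = ι g ≤ m, the divisor t j of m lies on the small side of the threshold; hence it
    -- divides t d′, and j ∣ d′.
    high-fits : ∀ {g} → (∃ λ j → ι g ≡ t * h′ * j × j ∣ c × t * j ∣ m) → Shape.Fits shape high (ι g) (ι g / ι y₀)
    high-fits {g} (j , ι≡j , j∣c , tj∣m) =
      trans ι≡j (cong₂ (λ h i → t * h * i) h′≡A (sym quot)) , subst (_∣ c) (sym quot) j∣c , subst (_∣ d′) (sym quot) (*-cancelˡ-∣ t tj∣td)
      where
      quot : ι g / ι y₀ ≡ j
      quot = trans (cong (_/ ι y₀) (trans ι≡j (trans (cong (_* j) (sym ι≡)) (*-comm (ι y₀) j)))) (m*n/n≡m j (ι y₀))
      ring : ∀ h t j → h * (t * j) ≡ t * h * j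
      ring = solve-∀
      j>0 : 0 < j
      j>0 = n≢0⇒n>0 λ j≡0 → >⇒≢ (ι>0 g) (trans ι≡j (trans (cong (t * h′ *_) j≡0) (*-zeroʳ (t * h′))))
      tj∣td : t * j ∣ t * d′
      tj∣td = ∣large (divides q (trans m≡dq (*-comm _ q))) m<hd (*-mono-< t>0 j>0) tj∣m
                (≤-trans (≤-reflexive (trans (ring h′ t j) (sym ι≡j))) (ι≤m g))

    fits : ∀ g → g ∈ G₀ → (D : Dec (ι g ∣ m)) (E : Dec (m < h′ * ι g)) → Shape.Fits shape (class-of D E) (ι g) (ι g / ι y₀)
    fits g g∈ (yes g∣m) (yes lt) = g∣m , divs g g∈ g∣m lt
    fits g g∈ (yes g∣m) (no ≮)   = g∣m , subst (ι g ∣_) (trans s≡ (*-comm c₁ t)) (small-∣ g∈ g∣m (≮⇒≥ ≮) (chain t (ι g) t∣m g∣m))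
    fits g g∈ (no g∤m)  _        = high-fits (ratio g∈ g∤m (to-high g∈ g∤m))

    -- That x divides A and b came from norms of particular atoms; conversely the `Shape` argument
    -- makes gcd A b divide every distance.
    x≡gcd : InΔG0 G₀ x → x ≡ gcd A b
    x≡gcd inΔ = ∣-antisym (gcd-greatest x∣A x∣b)
      (ModOne⇒∣Δ (Shape⇒ModOne I chain shape cls (λ g → ι g / ι y₀)
        (λ g g∈ → fits g g∈ (ι g ∣? m) (m <? h′ * ι g)) (gcd A b) (gcd[m,n]∣m A b) (gcd[m,n]∣n A b)) inΔ)

    inI : InΔG0 G₀ x → InI m′ x
    inI inΔ = c₁ , c , d′ , c₁>0 , c₁≤ , c>0 , c≤ , divides q (trans m′≡dq (*-comm d′ q)) , sum< ,
      A , b , A>0 , sym excess≡ , b>0 , b-eq , x≡gcd inΔ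
      where
      ring : ∀ c A c₁ → c * (1 + A * c₁) + c₁ ≡ c₁ + c + A * (c₁ * c)
      ring = solve-∀
      m′-sum : m′ ≡ c₁ + c + A * (c₁ * c)
      m′-sum = trans m′≡ (ring c A c₁)
      c₁≤ : c₁ ≤ m′
      c₁≤ = ≤-trans (m≤n+m c₁ _) (≤-reflexive (sym m′≡))
      c≤ : c ≤ m′
      c≤ = ≤-trans (≤-trans (m≤n+m c c₁) (m≤m+n _ _)) (≤-reflexive (sym m′-sum))
      sum< : c₁ + c < m′
      sum< = ≤-trans (m<m+n (c₁ + c) (*-mono-< A>0 (*-mono-< c₁>0 c>0))) (≤-reflexive (sym m′-sum))
      excess≡ : m′ ∸ c₁ ∸ c ≡ A * (c₁ * c)
      excess≡ = trans (∸-+-assoc m′ c₁ c) (trans (cong (_∸ (c₁ + c)) m′-sum) (m+n∸m≡n (c₁ + c) _))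
      bq≡ : b * q ≡ A * c₁
      bq≡ = suc-injective (trans (sym h′≡) h′≡A)
      ring₁ : ∀ b c d q → b * (c * (d * q)) ≡ b * q * (c * d)
      ring₁ = solve-∀
      ring₂ : ∀ A c₁ c d → A * c₁ * (c * d) ≡ A * (c₁ * c) * d
      ring₂ = solve-∀
      b-eq : b * (c * m′) ≡ (m′ ∸ c₁ ∸ c) * d′
      b-eq = trans (cong (λ k → b * (c * k)) m′≡dq) (trans (ring₁ b c d′ q) (trans (cong (_* (c * d′)) bq≡)
        (trans (ring₂ A c₁ c d′) (cong (_* d′) (sym excess≡)))))

-- From Δ*(G) to the sets I(m), and the theorem

Δ⇒nonempty : ∀ {n x} {G₀ : Subset n} → InΔG0 G₀ x → ∃ λ g → g ∈ G₀
Δ⇒nonempty (B , _ , over , x>0 , ℓ , _ , ([] , len≡ , _) , _) = contradiction (m+n≡0⇒n≡0 ℓ (sym len≡)) (>⇒≢ x>0)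
Δ⇒nonempty (B , _ , over , x>0 , ℓ , _ , (f ∷ fs , _ , (_ , f>0 , _) ∷ _ , prod) , _)
  with ⟨⟩-pos {v = f} (λ _ → 1) (subst (0 <_) (len-⟨⟩ f) f>0)
... | g , p = g , over g (≤-trans p (≤-trans (m≤m+n (f g) _) (≤-reflexive (prod g))))

-- With all weights dividing m, `fill` finds a norm-one divisor in every atom. Every distance would
-- then be a multiple of 0, so a set with a distance must have a weight that does not divide m.
divisor-weights⇒ModOne : ∀ {n m} {G₀ : Subset n} (I : Indexed n G₀ m) → DivisorChain m →
                         (∀ g → g ∈ G₀ → Indexed.ι I g ∣ m) → Norm.ModOne I 0
divisor-weights⇒ModOne {m = m} I chain div v N At =
  conclude (fill ι m v (λ g p → ι>0 g , div g (over g p))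
    (λ g h p q → chain (ι g) (ι h) (div g (over g p)) (div h (over h q)))
    (≤-trans (m≤n*m m N {{>-nonZero pos}}) (≤-reflexive (sym norm))))
  where
  open Indexed I
  open Norm I using (Atom-sub; module Atom)
  open Atom At
  conclude : (Σ _ λ w → w ≤ₛ v × ⟨ w , ι ⟩ ≡ m) → ∃ λ k → N ≡ suc (k * 0)
  conclude (w , le , eq) = 0 , Atom-sub 1 At le z<s (trans eq (sym (*-identityˡ m)))

Δstar⇒I : ∀ {n x} → 0 < n → DivisorChain n → 2 * n * n ≤ x * x * x → InΔstar n x → ∃ λ m → m ∣ n × InI m x
Δstar⇒I {n} {x} n>0 chain bound (G₀ , isMin@(inΔ@(_ , _ , _ , x>0 , _) , _)) = by-index (generated chain n>0 G₀ (Δ⇒nonempty inΔ))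
  where
  by-index : (∃ λ m → m ∣ n × Indexed n G₀ m) → ∃ λ m → m ∣ n × InI m x
  by-index (m , m∣n , I) = by-high (argmin (λ g → (g ∈? G₀) ×-dec ¬? (ι g ∣? m)) ι)
    where
    open Indexed I
    m≤n : m ≤ n
    m≤n = ∣⇒≤ {{>-nonZero n>0}} m∣n
    chain′ : DivisorChain m
    chain′ = DivisorChain-∣ m∣n chain
    bound′ : 2 * m * m ≤ x * x * x
    bound′ = ≤-trans (*-mono-≤ (*-monoʳ-≤ 2 m≤n) m≤n) bound
    open Forward I chain′ x x>0 bound′ (Norm.minΔ⇒ModOne I isMin) using (High; to-high)
    by-high : (∃ λ y → (y ∈ G₀ × ¬ (ι y ∣ m)) × (∀ g → g ∈ G₀ × ¬ (ι g ∣ m) → ι y ≤ ι g)) ⊎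
              (∀ g → ¬ (g ∈ G₀ × ¬ (ι g ∣ m))) → ∃ λ m → m ∣ n × InI m x
    by-high (inj₂ none) = contradiction (0∣⇒≡0 (Norm.ModOne⇒∣Δ I (divisor-weights⇒ModOne I chain′
      λ g g∈ → decidable-stable (ι g ∣? m) λ ∤m → none g (g∈ , ∤m)) inΔ)) (>⇒≢ x>0)
    by-high (inj₁ (y , (y∈ , ∤m) , least)) = conclude (to-high y∈ ∤m)
      where
      conclude : High y → ∃ λ m → m ∣ n × InI m x
      conclude Y = High.m′ Y , ∣-trans (divides (High.t Y) (High.m≡t Y)) m∣n , inI smallest-large inΔ
        where open Assemble I chain′ x x>0 bound′ (Norm.minΔ⇒ModOne I isMin) y y∈ Y (λ g g∈ ∤ → least g (g∈ , ∤))

theorem7p2 : (p k : ℕ) → Prime p → 1 ≤ k →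
    (x : ℕ) → 2 * (p ^ k) * (p ^ k) ≤ x * x * x →
    (InΔstar (p ^ k) x ⇔ ∃ λ m → m ∣ p ^ k × InI m x)
theorem7p2 p k p-prime _ x bound = mk⇔ (Δstar⇒I p^k>0 chain bound) λ (m , m∣ , inI) → I⇒Δstar p^k>0 chain m∣ inI
  where
  chain = p^k-DivisorChain p-prime k
  p^k>0 : 0 < p ^ k
  p^k>0 = m^n>0 p {{prime⇒nonZero p-prime}} k
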